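{- Let $G$ be a finite planar graph with no two intersecting triangles and such that every triangle of $G$ is adjacent to at most one $4$-cycle. Then $G$ is adaptably $3$-choosable (i.e. $\mathrm{ch}_{ad}(G)\le 3$), and hence $G$ is $(3,1)$-choosable.
   Context: A triangle is a $3$-cycle. Two cycles are adjacent if they share a common edge, and intersecting if they have at least one common vertex. Given a (possibly improper) edge coloring $F$ of $G$ with integers, a vertex coloring $c$ is adapted to $F$ if no edge $uv$ satisfies $c(u)=c(v)=F(uv)$. $G$ is adaptably $k$-choosable if for every edge coloring $F$ and every list assignment $L$ with $|L(v)|\ge k$ for all $v$, there is a coloring $c$ adapted to $F$ with $c(v)\in L(v)$ for all $v$; $\mathrm{ch}_{ad}(G)$ is the least such $k$. A $(k,d)$-list assignment assigns to each vertex a list of at least $k$ colors such that adjacent vertices' lists share at most $d$ colors; $G$ is $(k,d)$-choosable if for every such assignment $L$ there is a proper vertex coloring from the lists. -}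

module Defs where

open import Level using (0ℓ)
open import Data.Bool using (Bool; T)
open import Data.Nat using (ℕ; suc; _+_; _*_; _≤_)
open import Data.Nat.DivMod using (_mod_)
open import Data.Fin using (Fin; toℕ)
open import Data.Integer using (ℤ)
open import Data.Integer.Properties using (_≟_)
open import Data.List using (List; length; filter)
open import Data.List.Membership.Propositional using (_∈_)
open import Data.List.Membership.DecPropositional _≟_ using (_∈?_)
open import Data.List.Relation.Unary.Unique.Propositional using (Unique)
open import Data.List.Relation.Unary.Unique.Propositional.Properties using (filter⁺)
open import Data.Product using (∃-syntax; _×_)
open import Data.Sum using (_⊎_)
open import Function using (_∘_; _↔_; _⇔_; Inverse; Injective; StrictlySurjective)
open import Relation.Binary using (Rel)
open import Relation.Binary.Construct.Closure.Equivalence using (EqClosure)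
open import Relation.Binary.PropositionalEquality using (_≡_)
open import Relation.Nullary using (¬_)

-- Finite simple graphs.  Adjacency is Boolean so that an ordered pair of
-- vertices carries at most one proof of adjacency.

record Graph (n : ℕ) : Set where
  field
    adj       : Fin n → Fin n → Bool
    symmetric : ∀ {u v} → T (adj u v) → T (adj v u)
    loopless  : ∀ {v} → ¬ T (adj v v)

  Adj : Rel (Fin n) 0ℓ
  Adj u v = T (adj u v)

open Graph public using (Adj)

-- Planarity: G has a combinatorial embedding (rotation system) all of whose
-- components are spheres.

record Dart {n : ℕ} (G : Graph n) : Set where
  constructor dart
  field
    tail head : Fin n
    edge      : Adj G tail head

reverse : ∀ {n} {G : Graph n} → Dart G → Dart G
reverse {G = G} (dart u v e) = dart v u (Graph.symmetric G e)

-- When f is a permutation of a finite set, this is "x and y lie on the same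
-- cycle of f".
SameOrbit : {A : Set} → (A → A) → Rel A 0ℓ
SameOrbit f = EqClosure (λ x y → f x ≡ y)

record RotationSystem {n : ℕ} (G : Graph n) : Set where
  field
    rotation : Dart G ↔ Dart G

  σ : Dart G → Dart G
  σ = Inverse.to rotation

  field
    σ-tail   : ∀ d → Dart.tail (σ d) ≡ Dart.tail d
    σ-cyclic : ∀ d d′ → Dart.tail d ≡ Dart.tail d′ → SameOrbit σ d d′

  -- The orbits of φ are the boundary walks of the faces.
  φ : Dart G → Dart G
  φ = σ ∘ reverse

  SameComponent : Rel (Dart G) 0ℓ
  SameComponent = EqClosure (λ d d′ → σ d ≡ d′ ⊎ reverse d ≡ d′)

-- The equivalence relation R has exactly k classes.
record Classes {A : Set} (R : Rel A 0ℓ) (k : ℕ) : Set where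
  field
    class      : A → Fin k
    surjective : StrictlySurjective _≡_ class
    classifies : ∀ x y → class x ≡ class y ⇔ R x y

-- Euler's formula V − E + F = 2C.  All four numbers are counted on darts, so
-- isolated vertices, which do not affect planarity, are left out of V and C.
-- Every component has V − E + F ≤ 2, hence equality of the totals forces
-- genus 0 on each component.
record Planar {n : ℕ} (G : Graph n) : Set where
  field
    rotationSystem : RotationSystem G
  open RotationSystem rotationSystem public
  field
    V E F C    : ℕ
    vertices   : Classes (SameOrbit σ) V
    edges      : Classes (SameOrbit (reverse {G = G})) E
    faces      : Classes (SameOrbit φ) F
    components : Classes SameComponent C
    euler      : V + F ≡ E + 2 * C

-- Cycles are subgraphs: a Cycle is a traversal, and two traversals
-- describe the same cycle when they have the same edges.

next : ∀ {k} → Fin k → Fin k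
next {suc k} i = suc (toℕ i) mod suc k

record Cycle {n : ℕ} (G : Graph n) (k : ℕ) : Set where
  field
    3≤k       : 3 ≤ k
    vertex    : Fin k → Fin n
    injective : Injective _≡_ _≡_ vertex
    closed    : ∀ i → Adj G (vertex i) (vertex (next i))

  HasEdge : Rel (Fin n) 0ℓ
  HasEdge u v = ∃[ i ] ((u ≡ vertex i × v ≡ vertex (next i))
                      ⊎ (u ≡ vertex (next i) × v ≡ vertex i))

module _ {n : ℕ} {G : Graph n} where
  open Cycle

  SameCycle : ∀ {k l} → Cycle G k → Cycle G l → Set
  SameCycle c d = ∀ u v → HasEdge c u v ⇔ HasEdge d u v

  Adjacent : ∀ {k l} → Cycle G k → Cycle G l → Set
  Adjacent c d = ∃[ u ] ∃[ v ] (HasEdge c u v × HasEdge d u v)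

  Intersecting : ∀ {k l} → Cycle G k → Cycle G l → Set
  Intersecting c d = ∃[ i ] ∃[ j ] (vertex c i ≡ vertex d j)

Triangle : ∀ {n} → Graph n → Set
Triangle G = Cycle G 3

NoTwoIntersectingTriangles : ∀ {n} → Graph n → Set
NoTwoIntersectingTriangles G =
  (S T : Triangle G) → ¬ SameCycle S T → ¬ Intersecting S T

TrianglesAdjacentToAtMostOne4Cycle : ∀ {n} → Graph n → Set
TrianglesAdjacentToAtMostOne4Cycle G =
  (T : Triangle G) (c d : Cycle G 4) → Adjacent T c → Adjacent T d → SameCycle c d

record ColourSet : Set where
  constructor colourSet
  field
    elements : List ℤ
    unique   : Unique elements

open ColourSet

∣_∣ : ColourSet → ℕ
∣ A ∣ = length (elements A)

infix 4 _∈ᶜ_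
_∈ᶜ_ : ℤ → ColourSet → Set
x ∈ᶜ A = x ∈ elements A

infixr 7 _∩_
_∩_ : ColourSet → ColourSet → ColourSet
A ∩ B = colourSet (filter (_∈? elements B) (elements A))
                  (filter⁺ (_∈? elements B) (unique A))

record EdgeColouring {n : ℕ} (G : Graph n) : Set where
  field
    colour     : ∀ u v → Adj G u v → ℤ
    colour-sym : ∀ u v (e : Adj G u v) (e′ : Adj G v u) → colour u v e ≡ colour v u e′

module _ {n : ℕ} (G : Graph n) where

  ListAssignment : Set
  ListAssignment = Fin n → ColourSet

  VertexColouring : Set
  VertexColouring = Fin n → ℤ

  From : ListAssignment → VertexColouring → Set
  From L c = ∀ v → c v ∈ᶜ L v

  AdaptedTo : EdgeColouring G → VertexColouring → Set
  AdaptedTo F c = ∀ u v (e : Adj G u v) → ¬ (c u ≡ c v × c v ≡ EdgeColouring.colour F u v e)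

  Proper : VertexColouring → Set
  Proper c = ∀ u v → Adj G u v → ¬ c u ≡ c v

  AdaptablyChoosable : ℕ → Set
  AdaptablyChoosable k =
    (F : EdgeColouring G) (L : ListAssignment) → (∀ v → k ≤ ∣ L v ∣) →
    ∃[ c ] (AdaptedTo F c × From L c)

  -- k = ch_ad(G)
  IsAdaptableChoiceNumber : ℕ → Set
  IsAdaptableChoiceNumber k =
    AdaptablyChoosable k × (∀ j → AdaptablyChoosable j → k ≤ j)

  IsListAssignment : ℕ → ℕ → ListAssignment → Set
  IsListAssignment k d L =
    (∀ v → k ≤ ∣ L v ∣) × (∀ u v → Adj G u v → ∣ L u ∩ L v ∣ ≤ d)

  Choosable : ℕ → ℕ → Set
  Choosable k d =
    (L : ListAssignment) → IsListAssignment k d L →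
    ∃[ c ] (Proper c × From L c)

{-# OPTIONS --safe #-}
module Submission where

-- If the edges of G can be oriented with all out-degrees at most 2, let every vertex
-- avoid the colours of its two outgoing edges: a list of size 3 leaves it a colour, and
-- every edge is then respected by its tail.  By Hakimi's theorem such an orientation
-- exists as soon as every set S of vertices spans at most 2|S| edges.
--
-- To bound the number of edges spanned by S, one may assume that G[S] has minimum
-- degree at least 3.  Deleting the edges outside S one at a time keeps
-- V − E + F − 2C ≥ 0, so it suffices that the faces of G[S] have average length at
-- least 4.  A triangular face is adjacent to at most one 4-face and to no triangular
-- one, so it can take 1/2 from each of two faces of length k ≥ 5; as triangles do not
-- intersect, two consecutive edges of a face never both give, so such a face gives away
-- at most ⌊k/2⌋/2 ≤ k − 4.

open import Defs
open import Level using (0ℓ)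
open import Data.Bool using (Bool; true; false; not)
open import Data.Bool.Properties using (not-involutive; T-irrelevant; ¬-not) renaming (_≟_ to _≟ᵇ_)
open import Data.Empty using (⊥)
open import Data.Fin using (Fin; zero; suc; toℕ; punchIn; punchOut; combine)
open import Data.Fin.Patterns using (0F; 1F; 2F; 3F)
import Data.Fin.Properties as Fin
open import Data.Integer using (ℤ; 0ℤ)
import Data.Integer.Properties as ℤ
open import Data.List using (List; []; _∷_; _++_; length; filter; map; concat; allFin; lookup)
open import Data.List.Properties using (length-++; length-map; length-tabulate; map-++; filter-notAll)
open import Data.List.Membership.DecPropositional using () renaming (_∈?_ to member?)
open import Data.List.Membership.DecPropositional ℤ._≟_ using () renaming (_∈?_ to _∈ℤ?_)
open import Data.List.Membership.Propositional using (_∈_; _∉_; find; lose)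
open import Data.List.Membership.Propositional.Properties using (∈-∃++; ∈-++⁺ˡ; ∈-++⁺ʳ; ∈-++⁻; ∈-filter⁺; ∈-filter⁻; ∈-allFin; ∈-map⁺; ∈-map⁻; ∈-lookup)
open import Data.List.Relation.Unary.All as All using ([]; _∷_)
open import Data.List.Relation.Unary.AllPairs using ([]; _∷_)
open import Data.List.Relation.Unary.Any as Any using (here; there)
open import Data.List.Relation.Unary.Unique.Propositional using (Unique)
open import Data.List.Relation.Unary.Unique.Propositional.Properties using (++⁺; allFin⁺; filter⁺; map⁺)
open import Data.Nat using (ℕ; zero; suc; _+_; _*_; _≤_; _<_; z≤n; s≤s; s≤s⁻¹; _≤?_)
open import Data.Nat.ListAction using (sum)
open import Data.Nat.ListAction.Properties using (sum-++)
open import Data.Nat.Properties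
open import Data.Nat.Solver using (module +-*-Solver)
open import Data.Product using (Σ; ∃; ∃-syntax; _×_; _,_; proj₁; proj₂)
open import Data.Product.Properties using (≡-dec)
open import Data.Sum using (_⊎_; inj₁; inj₂)
open import Function using (_∘_; id; Equivalence; Injective; Inverse; StrictlySurjective)
open import Relation.Binary using (DecidableEquality)
import Relation.Binary.Construct.Closure.Equivalence as Eq
open import Relation.Binary.Construct.Closure.ReflexiveTransitive using (ε; _◅_)
open import Relation.Binary.Construct.Closure.Symmetric using (fwd; bwd)
open import Relation.Binary.PropositionalEquality
open import Relation.Nullary using (¬_; Dec; yes; no; ¬?; _×-dec_; _⊎-dec_; contradiction)
open import Relation.Nullary.Decidable using (decidable-stable)
open import Relation.Unary using (Pred; Decidable)
open +-*-Solver using (solve; _:+_; _:*_; _:=_; con)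

-- The hypotheses concern cycles, the discharging concerns faces; minimum degree 3 in G[S] links the
-- two. If the faces across two consecutive edges, or on the two sides of one edge, had to be
-- bounded by the same cycle, then the rotation at some vertex would close after two steps, and that
-- vertex would have degree 2.
--
-- Faces are never enumerated. Only a lower bound on their number is needed; a surjective map that
-- is constant along face walks certifies one, and it can be updated edge by edge. A deleted edge
-- leaves two dangling half-edges, so vertices, darts and rotation stay fixed and only the edge
-- involution changes. Face lengths are read off a second rotation, from which the dangling darts
-- are spliced out.
--
-- G[S] may be disconnected: S is counted as one component, and undercounting components only
-- weakens the inequality. Likewise, a face only has to show a stretch of at most six darts that is
-- heavy enough, so the length of a long face is never determined.

-- Finite sums

⟦_⟧ : {P : Set} → Dec P → ℕ
⟦ yes _ ⟧ = 1
⟦ no  _ ⟧ = 0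

module _ {A : Set} where

  sum-insert : (w : A → ℕ) (as : List A) {x : A} {bs : List A} →
    sum (map w (as ++ x ∷ bs)) ≡ w x + sum (map w (as ++ bs))
  sum-insert w [] = refl
  sum-insert w (a ∷ as) {x} {bs} = begin
    w a + sum (map w (as ++ x ∷ bs))      ≡⟨ cong (w a +_) (sum-insert w as) ⟩
    w a + (w x + sum (map w (as ++ bs)))  ≡⟨ +-assoc (w a) (w x) _ ⟨
    w a + w x + sum (map w (as ++ bs))    ≡⟨ cong (_+ sum (map w (as ++ bs))) (+-comm (w a) (w x)) ⟩
    w x + w a + sum (map w (as ++ bs))    ≡⟨ +-assoc (w x) (w a) _ ⟩
    w x + (w a + sum (map w (as ++ bs)))  ∎
    where open ≡-Reasoning

  ∈-delete : (as : List A) {x y : A} {bs : List A} → y ∈ as ++ x ∷ bs → y ≢ x → y ∈ as ++ bs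
  ∈-delete []       (here y≡x)  y≢x = contradiction y≡x y≢x
  ∈-delete []       (there y∈)  y≢x = y∈
  ∈-delete (a ∷ as) (here y≡a)  y≢x = here y≡a
  ∈-delete (a ∷ as) (there y∈)  y≢x = there (∈-delete as y∈ y≢x)

  sum-⊆ : (w : A → ℕ) {xs ys : List A} → Unique xs → (∀ {x} → x ∈ xs → x ∈ ys) →
    sum (map w xs) ≤ sum (map w ys)
  sum-⊆ w {[]} _ _ = z≤n
  sum-⊆ w {x ∷ xs} (x# ∷ uxs) xs⊆ys with ∈-∃++ (xs⊆ys (here refl))
  ... | as , bs , refl = begin
    w x + sum (map w xs)          ≤⟨ +-monoʳ-≤ (w x) (sum-⊆ w uxs λ y∈ → ∈-delete as (xs⊆ys (there y∈)) λ { refl → All.lookup x# y∈ refl }) ⟩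
    w x + sum (map w (as ++ bs))  ≡⟨ sum-insert w as ⟨
    sum (map w (as ++ x ∷ bs))    ∎
    where open ≤-Reasoning

  sum-mono : {f g : A → ℕ} (xs : List A) → (∀ {x} → x ∈ xs → f x ≤ g x) →
    sum (map f xs) ≤ sum (map g xs)
  sum-mono []       f≤g = z≤n
  sum-mono (x ∷ xs) f≤g = +-mono-≤ (f≤g (here refl)) (sum-mono xs (f≤g ∘ there))

  sum-const : (c : ℕ) (xs : List A) → sum (map (λ _ → c) xs) ≡ c * length xs
  sum-const c []       = sym (*-zeroʳ c)
  sum-const c (x ∷ xs) = trans (cong (c +_) (sum-const c xs)) (sym (*-suc c (length xs)))

  length-⊆ : {xs ys : List A} → Unique xs → (∀ {x} → x ∈ xs → x ∈ ys) → length xs ≤ length ys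
  length-⊆ {xs} {ys} u xs⊆ys = subst₂ _≤_ (ones xs) (ones ys) (sum-⊆ (λ _ → 1) u xs⊆ys)
    where
    ones : ∀ zs → sum (map (λ _ → 1) zs) ≡ length zs
    ones zs = trans (sum-const 1 zs) (*-identityˡ _)

  sum-update : {f g : A → ℕ} {xs : List A} {x : A} → Unique xs → x ∈ xs →
    (∀ {y} → y ≢ x → f y ≡ g y) → sum (map f xs) + g x ≡ sum (map g xs) + f x
  sum-update {f} {g} {x ∷ xs} (x# ∷ _) (here refl) f≗g = begin
    f x + sum (map f xs) + g x    ≡⟨ +-assoc (f x) _ _ ⟩
    f x + (sum (map f xs) + g x)  ≡⟨ +-comm (f x) _ ⟩
    sum (map f xs) + g x + f x    ≡⟨ cong (λ s → s + g x + f x) (cong-sum xs λ y∈ → f≗g λ { refl → All.lookup x# y∈ refl }) ⟩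
    sum (map g xs) + g x + f x    ≡⟨ cong (_+ f x) (+-comm _ (g x)) ⟩
    g x + sum (map g xs) + f x    ∎
    where
    open ≡-Reasoning
    cong-sum : ∀ zs → (∀ {y} → y ∈ zs → f y ≡ g y) → sum (map f zs) ≡ sum (map g zs)
    cong-sum []       eq = refl
    cong-sum (z ∷ zs) eq = cong₂ _+_ (eq (here refl)) (cong-sum zs (eq ∘ there))
  sum-update {f} {g} {z ∷ xs} {x} (z# ∷ u) (there x∈) f≗g = begin
    f z + sum (map f xs) + g x    ≡⟨ +-assoc (f z) _ _ ⟩
    f z + (sum (map f xs) + g x)  ≡⟨ cong₂ _+_ (f≗g λ { refl → All.lookup z# x∈ refl }) (sum-update u x∈ f≗g) ⟩
    g z + (sum (map g xs) + f x)  ≡⟨ +-assoc (g z) _ _ ⟨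
    g z + sum (map g xs) + f x    ∎
    where open ≡-Reasoning

  length-filter : {P : Pred A 0ℓ} (P? : Decidable P) (xs : List A) →
    length (filter P? xs) ≡ sum (map (λ x → ⟦ P? x ⟧) xs)
  length-filter P? [] = refl
  length-filter P? (x ∷ xs) with P? x
  ... | yes _ = cong suc (length-filter P? xs)
  ... | no  _ = length-filter P? xs

  length-partition : {P : Pred A 0ℓ} (P? : Decidable P) (xs : List A) →
    length xs ≡ length (filter P? xs) + length (filter (¬? ∘ P?) xs)
  length-partition P? [] = refl
  length-partition P? (x ∷ xs) with P? x
  ... | yes _ = cong suc (length-partition P? xs)
  ... | no  _ = trans (cong suc (length-partition P? xs)) (sym (+-suc _ _))

  escape : DecidableEquality A → {xs ys : List A} → Unique xs → length ys < length xs →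
    ∃[ x ] (x ∈ xs × x ∉ ys)
  escape _≟_ {xs} {ys} u ys<xs with Any.any? (λ x → ¬? (Any.any? (x ≟_) ys)) xs
  ... | yes some = find some
  ... | no none = contradiction
          (length-⊆ u λ {x} x∈ → decidable-stable (Any.any? (x ≟_) ys) λ x∉ → none (lose x∈ x∉))
          (<⇒≱ ys<xs)

-- Fibres of ℓ over distinct labels are disjoint.
sum-fibres : {A B : Set} (ℓ : A → B) (w : A → ℕ) (items : List A) {bs : List B} (fibre : B → List A) →
  Unique bs → (∀ b → b ∈ bs → Unique (fibre b) × (∀ {x} → x ∈ fibre b → x ∈ items × ℓ x ≡ b)) →
  sum (map (λ b → sum (map w (fibre b))) bs) ≤ sum (map w items)
sum-fibres {A} {B} ℓ w items {bs} fibre u ok = begin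
  sum (map (λ b → sum (map w (fibre b))) bs)  ≡⟨ flatten bs ⟨
  sum (map w (concat (map fibre bs)))         ≤⟨ sum-⊆ w (proj₁ (all bs u ok)) (proj₁ ∘ proj₂ ∘ proj₂ ∘ proj₂ (all bs u ok)) ⟩
  sum (map w items)                           ∎
  where
  open ≤-Reasoning
  flatten : ∀ cs → sum (map w (concat (map fibre cs))) ≡ sum (map (λ b → sum (map w (fibre b))) cs)
  flatten []       = refl
  flatten (c ∷ cs) = trans (cong sum (map-++ w (fibre c) _))
    (trans (sum-++ (map w (fibre c)) _) (cong (sum (map w (fibre c)) +_) (flatten cs)))
  all : ∀ cs → Unique cs → (∀ b → b ∈ cs → Unique (fibre b) × (∀ {x} → x ∈ fibre b → x ∈ items × ℓ x ≡ b)) →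
    Unique (concat (map fibre cs)) × (∀ {x} → x ∈ concat (map fibre cs) → ∃[ b ] (b ∈ cs × x ∈ items × ℓ x ≡ b))
  all []       _        _   = [] , λ ()
  all (c ∷ cs) (c# ∷ u) ok with all cs u (λ b → ok b ∘ there) | ok c (here refl)
  ... | ucs , mem | uc , memc =
    ++⁺ uc ucs (λ { (x∈c , x∈cs) → let b , b∈ , _ , eq = mem x∈cs in All.lookup c# b∈ (trans (sym (proj₂ (memc x∈c))) eq) }) ,
    λ x∈ → case (∈-++⁻ (fibre c) x∈)
    where
    case : ∀ {x} → x ∈ fibre c ⊎ x ∈ concat (map fibre cs) → ∃[ b ] (b ∈ c ∷ cs × x ∈ items × ℓ x ≡ b)
    case (inj₁ x∈) = c , here refl , memc x∈
    case (inj₂ x∈) = let b , b∈ , rest = mem x∈ in b , there b∈ , rest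

-- Orientations of sparse multigraphs

infix 4 _∈?_
abstract
  _∈?_ : ∀ {n} (v : Fin n) (S : List (Fin n)) → Dec (v ∈ S)
  _∈?_ = member? Fin._≟_

⟦⟧-true : {P : Set} (P? : Dec P) → P → ⟦ P? ⟧ ≡ 1
⟦⟧-true (yes _) _ = refl
⟦⟧-true (no ¬p) p = contradiction p ¬p

⟦⟧-false : {P : Set} (P? : Dec P) → ¬ P → ⟦ P? ⟧ ≡ 0
⟦⟧-false (yes p) ¬p = contradiction p ¬p
⟦⟧-false (no _)  _  = refl

≟-sym : ∀ {n} (x y : Fin n) → ⟦ x Fin.≟ y ⟧ ≡ ⟦ y Fin.≟ x ⟧
≟-sym x y with x Fin.≟ y
... | yes x≡y = sym (⟦⟧-true (y Fin.≟ x) (sym x≡y))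
... | no  x≢y = sym (⟦⟧-false (y Fin.≟ x) (x≢y ∘ sym))

module Orientation {n m : ℕ} (end : Fin m → Bool → Fin n) where

  Inside : List (Fin n) → Fin m → Set
  Inside S i = end i false ∈ S × end i true ∈ S

  inside? : ∀ S i → Dec (Inside S i)
  inside? S i = (end i false ∈? S) ×-dec (end i true ∈? S)

  module _ (es : List (Fin m)) (unique : Unique es) where

    out : (Fin m → Bool) → Fin n → ℕ
    out o v = sum (map (λ i → ⟦ end i (o i) Fin.≟ v ⟧) es)

    flip : Fin m → (Fin m → Bool) → Fin m → Bool
    flip i o j with i Fin.≟ j
    ... | yes _ = not (o j)
    ... | no  _ = o j

    flip-here : ∀ i o → flip i o i ≡ not (o i)
    flip-here i o with i Fin.≟ i
    ... | yes _ = refl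
    ... | no  i≢i = contradiction refl i≢i

    flip-there : ∀ {i j} o → j ≢ i → flip i o j ≡ o j
    flip-there {i} {j} o j≢i with i Fin.≟ j
    ... | yes i≡j = contradiction (sym i≡j) j≢i
    ... | no  _ = refl

    out-flip : ∀ {i} o v → i ∈ es →
      out (flip i o) v + ⟦ end i (o i) Fin.≟ v ⟧ ≡ out o v + ⟦ end i (not (o i)) Fin.≟ v ⟧
    out-flip {i} o v i∈ = subst (λ b → out (flip i o) v + ⟦ end i (o i) Fin.≟ v ⟧ ≡ out o v + ⟦ end i b Fin.≟ v ⟧)
      (flip-here i o)
      (sum-update unique i∈ λ {j} j≢i → cong (λ b → ⟦ end j b Fin.≟ v ⟧) (flip-there o j≢i))

    module _ (sparse : ∀ S → Unique S → length (filter (inside? S) es) ≤ 2 * length S)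
             (o : Fin m → Bool) (v₀ : Fin n) (out≤ : ∀ v → out o v ≤ 2 + ⟦ v Fin.≟ v₀ ⟧) where

      -- One unit of out-degree can be moved from v₀ to u by reversing edges inside S.
      Reach : List (Fin n) → Fin n → Set
      Reach S u = ∃[ o′ ] ((∀ i → ¬ Inside S i → o′ i ≡ o i) ×
                           (∀ v → out o′ v + ⟦ v Fin.≟ v₀ ⟧ ≡ out o v + ⟦ v Fin.≟ u ⟧))

      Inside-there : ∀ {S w i} → Inside S i → Inside (w ∷ S) i
      Inside-there (p , q) = there p , there q

      Reach-there : ∀ {S w u} → Reach S u → Reach (w ∷ S) u
      Reach-there (o′ , same , deg) = o′ , (λ i ¬in → same i (¬in ∘ Inside-there)) , deg

      end∉⇒¬Inside : ∀ {S i} b → end i b ∉ S → ¬ Inside S i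
      end∉⇒¬Inside false ∉S (p , _) = ∉S p
      end∉⇒¬Inside true  ∉S (_ , q) = ∉S q

      owned-inside : ∀ {S i} b → end i b ∈ S → end i (not b) ∈ S → Inside S i
      owned-inside false p q = p , q
      owned-inside true  p q = q , p

      -- The edge `i` leaves `S`, hence is not inside `S`, and so `o′` still directs it from `u` to
      -- `w`: reversing it passes the unit on. This is why `Reach` leaves all edges that are not
      -- inside `S` untouched.
      Reach-step : ∀ {S i} → i ∈ es → Reach S (end i (o i)) → end i (o i) ∈ S → end i (not (o i)) ∉ S →
        Reach (end i (not (o i)) ∷ S) (end i (not (o i)))
      Reach-step {S} {i} i∈ (o′ , same , deg) u∈S w∉S = flip i o′ , same′ , deg′
        where
        u w : Fin n
        u = end i (o i)
        w = end i (not (o i))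
        o′i : o′ i ≡ o i
        o′i = same i (end∉⇒¬Inside (not (o i)) w∉S)
        same′ : ∀ j → ¬ Inside (w ∷ S) j → flip i o′ j ≡ o j
        same′ j ¬in with j Fin.≟ i
        ... | yes refl = contradiction (owned-inside (o i) (there u∈S) (here refl)) ¬in
        ... | no  j≢i  = trans (flip-there o′ j≢i) (same j (¬in ∘ Inside-there))
        flipped : ∀ v → out (flip i o′) v + ⟦ v Fin.≟ u ⟧ ≡ out o′ v + ⟦ v Fin.≟ w ⟧
        flipped v = begin
          out (flip i o′) v + ⟦ v Fin.≟ u ⟧            ≡⟨ cong (out (flip i o′) v +_) (≟-sym v u) ⟩
          out (flip i o′) v + ⟦ u Fin.≟ v ⟧            ≡⟨ cong (λ b → out (flip i o′) v + ⟦ end i b Fin.≟ v ⟧) o′i ⟨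
          out (flip i o′) v + ⟦ end i (o′ i) Fin.≟ v ⟧ ≡⟨ out-flip o′ v i∈ ⟩
          out o′ v + ⟦ end i (not (o′ i)) Fin.≟ v ⟧    ≡⟨ cong (λ b → out o′ v + ⟦ end i (not b) Fin.≟ v ⟧) o′i ⟩
          out o′ v + ⟦ w Fin.≟ v ⟧                     ≡⟨ cong (out o′ v +_) (≟-sym w v) ⟩
          out o′ v + ⟦ v Fin.≟ w ⟧                     ∎
          where open ≡-Reasoning
        deg′ : ∀ v → out (flip i o′) v + ⟦ v Fin.≟ v₀ ⟧ ≡ out o v + ⟦ v Fin.≟ w ⟧
        deg′ v = +-cancelʳ-≡ (⟦ v Fin.≟ u ⟧ + out o′ v) _ _ (begin
          a + p + (q + b) ≡⟨ solve 4 (λ a p q b → a :+ p :+ (q :+ b) := (a :+ q) :+ (b :+ p)) refl a p q b ⟩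
          (a + q) + (b + p) ≡⟨ cong₂ _+_ (flipped v) (deg v) ⟩
          (b + r) + (c + q) ≡⟨ solve 4 (λ b r c q → (b :+ r) :+ (c :+ q) := c :+ r :+ (q :+ b)) refl b r c q ⟩
          c + r + (q + b) ∎)
          where
          open ≡-Reasoning
          a b c p q r : ℕ
          a = out (flip i o′) v
          b = out o′ v
          c = out o v
          p = ⟦ v Fin.≟ v₀ ⟧
          q = ⟦ v Fin.≟ u ⟧
          r = ⟦ v Fin.≟ w ⟧

      Balanced : Set
      Balanced = ∃[ o′ ] (∀ v → out o′ v ≤ 2)

      finish : ∀ {S w} → Reach S w → w ≢ v₀ → out o w ≤ 1 → Balanced
      finish {S} {w} (o′ , _ , deg) w≢v₀ out≤1 = o′ , bound
        where
        open ≤-Reasoning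
        bound : ∀ v → out o′ v ≤ 2
        bound v with v Fin.≟ w | deg v
        ... | yes refl | eq = begin
          out o′ v                       ≤⟨ m≤m+n _ _ ⟩
          out o′ v + ⟦ v Fin.≟ v₀ ⟧      ≡⟨ eq ⟩
          out o v + 1                    ≤⟨ +-monoˡ-≤ 1 out≤1 ⟩
          2                              ∎
        ... | no _ | eq = +-cancelʳ-≤ ⟦ v Fin.≟ v₀ ⟧ _ _ (begin
          out o′ v + ⟦ v Fin.≟ v₀ ⟧      ≡⟨ trans eq (+-identityʳ _) ⟩
          out o v                        ≤⟨ out≤ v ⟩
          2 + ⟦ v Fin.≟ v₀ ⟧             ∎)

      -- If no edge leaves `S`, all edges owned by vertices of `S` lie inside `S`. Each vertex owns
      -- at least 2 of them and `v₀` at least 3, which makes 2|S| + 1 and contradicts sparsity.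
      closed-overfull : ∀ {S} → Unique S → v₀ ∈ S → (∀ {u} → u ∈ S → 2 + ⟦ u Fin.≟ v₀ ⟧ ≤ out o u) →
        ¬ (∀ i → i ∈ es → end i (o i) ∈ S → end i (not (o i)) ∈ S)
      closed-overfull {S} uS v₀∈S full closed = <-irrefl refl (begin-strict
        2 * length S                                        <⟨ m<m+n _ (s≤s z≤n) ⟩
        2 * length S + 1                                    ≤⟨ +-monoʳ-≤ (2 * length S) hit ⟩
        2 * length S + sum (map (λ u → ⟦ u Fin.≟ v₀ ⟧) S)   ≡⟨ split S ⟨
        sum (map (λ u → 2 + ⟦ u Fin.≟ v₀ ⟧) S)              ≤⟨ sum-mono S full ⟩
        sum (map (out o) S)                                 ≤⟨ sum-mono S (λ {u} _ → ≤-reflexive (out-fibre u)) ⟩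
        sum (map (λ u → sum (map (λ _ → 1) (fibre u))) S)   ≤⟨ sum-fibres owner (λ _ → 1) (filter (inside? S) es) fibre uS fibre-ok ⟩
        sum (map (λ _ → 1) (filter (inside? S) es))         ≡⟨ trans (sum-const 1 (filter (inside? S) es)) (*-identityˡ _) ⟩
        length (filter (inside? S) es)                      ≤⟨ sparse S uS ⟩
        2 * length S                                        ∎)
        where
        open ≤-Reasoning
        owner : Fin m → Fin n
        owner i = end i (o i)
        fibre : Fin n → List (Fin m)
        fibre u = filter (λ i → owner i Fin.≟ u) es
        out-fibre : ∀ u → out o u ≡ sum (map (λ _ → 1) (fibre u))
        out-fibre u = trans (sym (length-filter (λ i → owner i Fin.≟ u) es))
          (sym (trans (sum-const 1 (fibre u)) (*-identityˡ _)))
        fibre-ok : ∀ u → u ∈ S → Unique (fibre u) × (∀ {i} → i ∈ fibre u → i ∈ filter (inside? S) es × owner i ≡ u)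
        fibre-ok u u∈S = filter⁺ (λ i → owner i Fin.≟ u) unique , λ {i} i∈ →
          let i∈es , owner≡u = ∈-filter⁻ (λ i → owner i Fin.≟ u) i∈
              owner∈S = subst (_∈ S) (sym owner≡u) u∈S
          in ∈-filter⁺ (inside? S) i∈es (owned-inside (o i) owner∈S (closed i i∈es owner∈S)) , owner≡u
        hit : 1 ≤ sum (map (λ u → ⟦ u Fin.≟ v₀ ⟧) S)
        hit = subst (_≤ sum (map (λ u → ⟦ u Fin.≟ v₀ ⟧) S))
          (trans (+-identityʳ _) (⟦⟧-true (v₀ Fin.≟ v₀) refl))
          (sum-⊆ (λ u → ⟦ u Fin.≟ v₀ ⟧) {xs = v₀ ∷ []} ([] ∷ []) λ { (here refl) → v₀∈S })
        split : ∀ T → sum (map (λ u → 2 + ⟦ u Fin.≟ v₀ ⟧) T) ≡ 2 * length T + sum (map (λ u → ⟦ u Fin.≟ v₀ ⟧) T)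
        split []      = refl
        split (u ∷ T) = trans (cong (2 + ⟦ u Fin.≟ v₀ ⟧ +_) (split T))
          (solve 3 (λ x l s → (con 2 :+ x) :+ (con 2 :* l :+ s) := con 2 :* (con 1 :+ l) :+ (x :+ s)) refl ⟦ u Fin.≟ v₀ ⟧ (length T) (sum (map (λ u → ⟦ u Fin.≟ v₀ ⟧) T)))

      -- Search along directed edges from `v₀`. Every vertex of `S` is full, so `S` cannot be
      -- closed; the head `w` of a leaving edge either has room for the unit or joins `S`. The fuel
      -- runs out only at |S| = n + 1, which is impossible.
      grow : ∀ fuel S → fuel + length S ≡ suc n → Unique S → v₀ ∈ S →
        (∀ {u} → u ∈ S → Reach S u × 2 + ⟦ u Fin.≟ v₀ ⟧ ≤ out o u) → Balanced
      grow zero S eq uS _ _ = contradiction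
        (subst₂ _≤_ eq (length-tabulate id) (length-⊆ uS (λ {v} _ → ∈-allFin v))) 1+n≰n
      grow (suc fuel) S eq uS v₀∈S ok
        with Any.any? (λ i → (end i (o i) ∈? S) ×-dec ¬? (end i (not (o i)) ∈? S)) es
      ... | no none = contradiction
        (λ i i∈ u∈S → decidable-stable (end i (not (o i)) ∈? S) λ w∉S → none (lose i∈ (u∈S , w∉S)))
        (closed-overfull uS v₀∈S (proj₂ ∘ ok))
      ... | yes some with find some
      ... | i , i∈ , u∈S , w∉S = continue (out o w ≤? 1)
        where
        w : Fin n
        w = end i (not (o i))
        w≢v₀ : w ≢ v₀
        w≢v₀ w≡v₀ = w∉S (subst (_∈ S) (sym w≡v₀) v₀∈S)
        reach-w : Reach (w ∷ S) w
        reach-w = Reach-step i∈ (proj₁ (ok u∈S)) u∈S w∉S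
        continue : Dec (out o w ≤ 1) → Balanced
        continue (yes out≤1) = finish reach-w w≢v₀ out≤1
        continue (no out≰1) = grow fuel (w ∷ S) (trans (+-suc fuel (length S)) eq)
          (All.tabulate (λ { u∈ refl → w∉S u∈ }) ∷ uS) (there v₀∈S) ok′
          where
          ok′ : ∀ {u} → u ∈ w ∷ S → Reach (w ∷ S) u × 2 + ⟦ u Fin.≟ v₀ ⟧ ≤ out o u
          ok′ (here refl) = reach-w ,
            subst (λ k → 2 + k ≤ out o w) (sym (⟦⟧-false (w Fin.≟ v₀) w≢v₀)) (≰⇒> out≰1)
          ok′ (there u∈) = Reach-there (proj₁ (ok u∈)) , proj₂ (ok u∈)

      rebalance : Balanced
      rebalance with out o v₀ ≤? 2
      ... | yes out≤2 = o , bound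
        where
        bound : ∀ v → out o v ≤ 2
        bound v with v Fin.≟ v₀ | out≤ v
        ... | yes refl | _  = out≤2
        ... | no _     | le = le
      ... | no out≰2 = grow n (v₀ ∷ []) (+-comm n 1) ([] ∷ []) (here refl)
        λ { (here refl) → (o , (λ _ _ → refl) , (λ _ → refl)) ,
              subst (λ k → 2 + k ≤ out o v₀) (sym (⟦⟧-true (v₀ Fin.≟ v₀) refl)) (≰⇒> out≰2) }

  -- Hakimi's theorem for out-degree 2.
  orient : ∀ es (u : Unique es) → (∀ S → Unique S → length (filter (inside? S) es) ≤ 2 * length S) →
    ∃[ o ] (∀ v → out es u o v ≤ 2)
  orient [] _ _ = (λ _ → false) , λ _ → z≤n
  orient (e ∷ es) (e# ∷ u) sparse with orient es u (λ S uS → ≤-trans (drop S) (sparse S uS))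
    where
    drop : ∀ S → length (filter (inside? S) es) ≤ length (filter (inside? S) (e ∷ es))
    drop S = length-⊆ (filter⁺ (inside? S) u) λ i∈ →
      let i∈es , in-S = ∈-filter⁻ (inside? S) i∈ in ∈-filter⁺ (inside? S) (there i∈es) in-S
  -- The new edge starts with the direction that `o` happens to give it, so only its owner can
  -- exceed 2, and only by one.
  ... | o , bound = rebalance (e ∷ es) (e# ∷ u) sparse o (end e (o e))
    λ v → ≤-trans (+-mono-≤ (≤-reflexive (≟-sym (end e (o e)) v)) (bound v)) (≤-reflexive (+-comm ⟦ v Fin.≟ end e (o e) ⟧ 2))

-- Deleting edges of a plane map

iter : {A : Set} → (A → A) → ℕ → A → A
iter f zero    x = x
iter f (suc k) x = iter f k (f x)

module _ {A : Set} (f : A → A) where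

  iter-+ : ∀ j k x → iter f (j + k) x ≡ iter f k (iter f j x)
  iter-+ zero    k x = refl
  iter-+ (suc j) k x = iter-+ j k (f x)

  module _ (f-inj : Injective _≡_ _≡_ f) where

    iter-injective : ∀ k → Injective _≡_ _≡_ (iter f k)
    iter-injective zero    eq = eq
    iter-injective (suc k) eq = f-inj (iter-injective k eq)

    module _ {N : ℕ} {code : A → Fin N} (code-inj : Injective _≡_ _≡_ code) where

      period : ∀ x → ∃[ k ] iter f (suc k) x ≡ x
      period x with Fin.pigeonhole (n<1+n N) (λ i → code (iter f (toℕ i) x))
      ... | i , j , i<j , eq with m≤n⇒∃[o]m+o≡n i<j
      ... | k , i+k≡j = k , sym (iter-injective (toℕ i) (begin
        iter f (toℕ i) x                     ≡⟨ code-inj eq ⟩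
        iter f (toℕ j) x                     ≡⟨ cong (λ t → iter f t x) (trans (sym i+k≡j) (cong suc (+-comm (toℕ i) k))) ⟩
        iter f (suc k + toℕ i) x             ≡⟨ iter-+ (suc k) (toℕ i) x ⟩
        iter f (toℕ i) (iter f (suc k) x)    ∎))
        where open ≡-Reasoning

      -- A backward step from `f z` to `z` is replaced by the rest of the period of `z`, so forward
      -- steps suffice.
      orbit⇒iter : ∀ {x y} → SameOrbit f x y → ∃[ k ] iter f k x ≡ y
      orbit⇒iter ε = 0 , refl
      orbit⇒iter (fwd refl ◅ rest) = let k , eq = orbit⇒iter rest in suc k , eq
      orbit⇒iter (_◅_ {j = z} (bwd refl) rest) =
        let k , back = period z
            j , eq   = orbit⇒iter rest
        in k + j , trans (iter-+ k j (f z)) (trans (cong (iter f j) back) eq)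

merge : ∀ {k} (p q : Fin (suc k)) → p ≢ q →
  Σ (Fin (suc k) → Fin k) λ m → StrictlySurjective _≡_ m × m p ≡ m q
merge p q p≢q = m , surj , m-eq
  where
  m : Fin _ → Fin _
  m x with p Fin.≟ x
  ... | yes _  = punchOut p≢q
  ... | no p≢x = punchOut p≢x
  m-out : ∀ {x} (p≢x : p ≢ x) → m x ≡ punchOut p≢x
  m-out {x} p≢x with p Fin.≟ x
  ... | yes p≡x = contradiction p≡x p≢x
  ... | no _    = Fin.punchOut-cong p refl
  surj : StrictlySurjective _≡_ m
  surj y = punchIn p y , trans (m-out (Fin.punchInᵢ≢i p y ∘ sym)) (Fin.punchOut-punchIn p)
  m-eq : m p ≡ m q
  m-eq with p Fin.≟ p
  ... | yes _  = sym (m-out p≢q)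
  ... | no p≢p = contradiction refl p≢p

-- A certificate that `f` has at least `k` orbits: each orbit gets one label, but several orbits may
-- share it.
record Labelling {A : Set} (f : A → A) (k : ℕ) : Set where
  field
    label      : A → Fin k
    surjective : StrictlySurjective _≡_ label
    invariant  : ∀ x → label (f x) ≡ label x

open Labelling

-- The darts of a multigraph with m edges: (i , b) and (i , not b) are the two
-- directions of edge i.
D : ℕ → Set
D m = Fin m × Bool

module Darts {m : ℕ} where

  infix 4 _≟ᴰ_
  _≟ᴰ_ : DecidableEquality (D m)
  _≟ᴰ_ = ≡-dec Fin._≟_ _≟ᵇ_

  code : D m → Fin (m * 2)
  code (i , false) = combine i zero
  code (i , true)  = combine i (suc zero)

  code-injective : Injective _≡_ _≡_ code
  code-injective {i , false} {j , false} eq = cong (_, false) (Fin.combine-injectiveˡ i zero j zero eq)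
  code-injective {i , true}  {j , true}  eq = cong (_, true) (Fin.combine-injectiveˡ i (suc zero) j (suc zero) eq)
  code-injective {i , false} {j , true}  eq = contradiction (Fin.combine-injectiveʳ i zero j (suc zero) eq) λ ()
  code-injective {i , true}  {j , false} eq = contradiction (Fin.combine-injectiveʳ i (suc zero) j zero eq) λ ()

  rev : D m → D m
  rev (i , b) = i , not b

  rev-involutive : ∀ x → rev (rev x) ≡ x
  rev-involutive (i , b) = cong (i ,_) (not-involutive b)

  rev-injective : Injective _≡_ _≡_ rev
  rev-injective {x} {y} eq = trans (sym (rev-involutive x)) (trans (cong rev eq) (rev-involutive y))

  -- Deleting the edges es turns their darts into dangling half-edges.
  α : List (Fin m) → D m → D m
  α es x with proj₁ x ∈? es
  ... | yes _ = x
  ... | no  _ = rev x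

  α-∈ : ∀ {es x} → proj₁ x ∈ es → α es x ≡ x
  α-∈ {es} {x} x∈ with proj₁ x ∈? es
  ... | yes _  = refl
  ... | no  x∉ = contradiction x∈ x∉

  α-∉ : ∀ {es x} → proj₁ x ∉ es → α es x ≡ rev x
  α-∉ {es} {x} x∉ with proj₁ x ∈? es
  ... | yes x∈ = contradiction x∈ x∉
  ... | no  _  = refl

  α-involutive : ∀ es x → α es (α es x) ≡ x
  α-involutive es x with proj₁ x ∈? es
  ... | yes x∈ = α-∈ x∈
  ... | no  x∉ = trans (α-∉ x∉) (rev-involutive x)

  α-injective : ∀ es → Injective _≡_ _≡_ (α es)
  α-injective es {x} {y} eq = trans (sym (α-involutive es x)) (trans (cong (α es) eq) (α-involutive es y))

  α-∷ : ∀ {e es x} → proj₁ x ≢ e → α (e ∷ es) x ≡ α es x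
  α-∷ {e} {es} {x} x≢e = go (proj₁ x ∈? es)
    where
    go : Dec (proj₁ x ∈ es) → α (e ∷ es) x ≡ α es x
    go (yes x∈) = trans (α-∈ (there x∈)) (sym (α-∈ x∈))
    go (no  x∉) = trans (α-∉ λ { (here x≡e) → x≢e x≡e ; (there x∈) → x∉ x∈ }) (sym (α-∉ x∉))

  module _ (σ : D m → D m) (σ-injective : Injective _≡_ _≡_ σ) where

    module _ {e : Fin m} {es : List (Fin m)} (e∉es : e ∉ es) where

      private
        d d′ : D m
        d  = e , false
        d′ = e , true
        f f′ : D m → D m
        f  = σ ∘ α es
        f′ = σ ∘ α (e ∷ es)

      f-d : f d ≡ σ d′
      f-d = cong σ (α-∉ e∉es)

      f-d′ : f d′ ≡ σ d
      f-d′ = cong σ (α-∉ e∉es)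

      f′-dangling : ∀ b → f′ (e , b) ≡ σ (e , b)
      f′-dangling b = cong σ (α-∈ (here refl))

      f′-other : ∀ {x} → proj₁ x ≢ e → f′ x ≡ f x
      f′-other x≢e = cong σ (α-∷ x≢e)

      f′-injective : Injective _≡_ _≡_ f′
      f′-injective eq = α-injective (e ∷ es) (σ-injective eq)

      -- Deleting `e` merely exchanges the successors of its two darts: `f′ d` is `f d′` and `f′ d′`
      -- is `f d`. A labelling that does not tell `d` from `d′` cannot notice.
      invariant-glued : {B : Set} (ℓ : D m → B) → (∀ x → ℓ (f x) ≡ ℓ x) → ℓ d ≡ ℓ d′ →
        ∀ x → ℓ (f′ x) ≡ ℓ x
      invariant-glued ℓ inv glue (i , b) with i Fin.≟ e | b
      ... | no  i≢e  | _     = trans (cong ℓ (f′-other i≢e)) (inv _)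
      ... | yes refl | false = trans (cong ℓ (trans (f′-dangling false) (sym f-d′))) (trans (inv d′) (sym glue))
      ... | yes refl | true  = trans (cong ℓ (trans (f′-dangling true) (sym f-d))) (trans (inv d) glue)

      -- If κ separates the two ends of e after its deletion, then e was a bridge,
      -- so the face to its left is also the face to its right.
      bridge : ∀ {k} (L : Labelling f k) {B : Set} (κ : D m → B) → (∀ x → κ (f′ x) ≡ κ x) → κ d ≢ κ d′ →
        label L d ≡ label L d′
      bridge L κ inv κd≢κd′ with period f′ f′-injective code-injective d′
      -- After the deletion, follow the face from `f′ d′`, which is `f d`, until it returns to `d′`.
      -- Since `κ` is constant on this walk, it never meets `d`; up to its end it is therefore a
      -- walk of the old face permutation and keeps the label of `d`.
      ... | k , loop = walk k (inv d′) start loop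
        where
        start : label L (f′ d′) ≡ label L d
        start = trans (cong (label L) (trans (f′-dangling true) (sym f-d))) (invariant L d)
        walk : ∀ j {y} → κ y ≡ κ d′ → label L y ≡ label L d → iter f′ j y ≡ d′ → label L d ≡ label L d′
        walk zero    _  ly eq = trans (sym ly) (cong (label L) eq)
        walk (suc j) {i , b} κy ly eq with i Fin.≟ e | b
        ... | yes refl | true  = sym ly
        ... | yes refl | false = contradiction κy κd≢κd′
        ... | no  i≢e  | _     = walk j (trans (inv _) κy)
          (trans (cong (label L) (f′-other i≢e)) (trans (invariant L _) ly)) eq

      delete-glued : ∀ {k} (L : Labelling f k) → label L d ≡ label L d′ → Labelling f′ k
      delete-glued L glue = record
        { label = label L ; surjective = surjective L
        ; invariant = invariant-glued (label L) (invariant L) glue }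

      delete-merge : ∀ {k} (L : Labelling f (suc k)) → label L d ≢ label L d′ → Labelling f′ k
      delete-merge L p≢q with merge (label L d) (label L d′) p≢q
      ... | μ , μ-surj , μ-eq = record
        { label      = μ ∘ label L
        ; surjective = λ y → let z , eq = μ-surj y ; x , eq′ = surjective L z in x , trans (cong μ eq′) eq
        ; invariant  = invariant-glued (μ ∘ label L) (λ x → cong μ (invariant L x)) μ-eq }

      -- By `bridge` both sides of `e` carry one label. Deleting `e` breaks that class in two, and
      -- `κ` tells the halves apart: the half on the side of `d` becomes `zero`, while the half
      -- containing `d′` keeps the old label.
      delete-split : ∀ {k} (L : Labelling f k) {K} (κ : D m → Fin K) → (∀ x → κ (f′ x) ≡ κ x) → κ d ≢ κ d′ →
        Labelling f′ (suc k)
      delete-split {k} L {K} κ inv κd≢κd′ = record { label = new ; surjective = surj ; invariant = inv′ }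
        where
        glue : label L d ≡ label L d′
        glue = bridge L κ inv κd≢κd′
        pick : ∀ {p q} → Dec (p ≡ label L d) → Dec (q ≡ κ d) → Fin k → Fin (suc k)
        pick (yes _) (yes _) _ = zero
        pick _       _       p = suc p
        pick′ : Fin k → Fin K → Fin (suc k)
        pick′ p q = pick (p Fin.≟ label L d) (q Fin.≟ κ d) p
        new : D m → Fin (suc k)
        new x = pick′ (label L x) (κ x)
        inv′ : ∀ x → new (f′ x) ≡ new x
        inv′ x = cong₂ pick′ (invariant-glued (label L) (invariant L) glue x) (inv x)
        new-d : new d ≡ zero
        new-d with label L d Fin.≟ label L d | κ d Fin.≟ κ d
        ... | yes _ | yes _ = refl
        ... | no ne | _     = contradiction refl ne
        ... | _     | no ne = contradiction refl ne
        new-d′ : new d′ ≡ suc (label L d′)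
        new-d′ with label L d′ Fin.≟ label L d | κ d′ Fin.≟ κ d
        ... | _     | yes eq = contradiction (sym eq) κd≢κd′
        ... | yes _ | no _   = refl
        ... | no _  | no _   = refl
        new-off : ∀ {x} → label L x ≢ label L d → new x ≡ suc (label L x)
        new-off {x} ne with label L x Fin.≟ label L d | κ x Fin.≟ κ d
        ... | yes eq | _     = contradiction eq ne
        ... | no _   | yes _ = refl
        ... | no _   | no _  = refl
        old : ∀ p → ∃[ x ] new x ≡ suc p
        old p with p Fin.≟ label L d | surjective L p
        ... | yes refl | _        = d′ , trans new-d′ (cong suc (sym glue))
        ... | no p≢    | x , refl = x , new-off p≢
        surj : StrictlySurjective _≡_ new
        surj zero    = d , new-d
        surj (suc p) = old p

    module _ {F C : ℕ} (faces : Labelling (σ ∘ rev) F)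
             (components : ∀ {K} (κ : Labelling σ K) → (∀ x → label κ (rev x) ≡ label κ x) → K ≤ C) where

      -- This is the one-sided Euler inequality, with `κ` a lower bound for the components after the
      -- deletion. Restoring `e` leaves `κ` valid if it agrees at the ends of `e`; then deleting `e`
      -- costs at most one face, paid by the edge count. Otherwise two labels of `κ` are merged, and
      -- the deletion adds one component and one face: 2 on the left, 1 + 1 on the right.
      delete-edges : ∀ es → Unique es → ∀ {K} (κ : Labelling σ K) → (∀ x → label κ (α es x) ≡ label κ x) →
        ∃[ F′ ] (Labelling (σ ∘ α es) F′ × F + 2 * K ≤ F′ + length es + 2 * C)
      delete-edges [] _ {K} κ inv = F , faces′ , (begin
        F + 2 * K          ≤⟨ +-monoʳ-≤ F (*-monoʳ-≤ 2 (components κ λ x → trans (cong (label κ) (sym (α-∉ λ ()))) (inv x))) ⟩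
        F + 2 * C          ≡⟨ cong (_+ 2 * C) (+-identityʳ F) ⟨
        F + 0 + 2 * C      ∎)
        where
        open ≤-Reasoning
        faces′ : Labelling (σ ∘ α []) F
        faces′ = record
          { label = label faces ; surjective = surjective faces
          ; invariant = λ x → trans (cong (label faces ∘ σ) (α-∉ λ ())) (invariant faces x) }
      delete-edges (e ∷ es) (e# ∷ u) {K} κ inv = split K κ inv (label κ (e , false) Fin.≟ label κ (e , true))
        where
        open ≤-Reasoning
        e∉es : e ∉ es
        e∉es e∈ = All.lookup e# e∈ refl

        restore : ∀ {B : Set} (κ : D m → B) → (∀ x → κ (α (e ∷ es) x) ≡ κ x) → κ (e , false) ≡ κ (e , true) →
          ∀ x → κ (α es x) ≡ κ x
        restore κ inv eq (i , b) with i Fin.≟ e | b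
        ... | no  i≢e  | _     = trans (cong κ (sym (α-∷ i≢e))) (inv _)
        ... | yes refl | false = trans (cong κ (α-∉ e∉es)) (sym eq)
        ... | yes refl | true  = trans (cong κ (α-∉ e∉es)) eq

        split : ∀ K (κ : Labelling σ K) → (∀ x → label κ (α (e ∷ es) x) ≡ label κ x) →
          Dec (label κ (e , false) ≡ label κ (e , true)) →
          ∃[ F′ ] (Labelling (σ ∘ α (e ∷ es)) F′ × F + 2 * K ≤ F′ + suc (length es) + 2 * C)
        split K κ inv (yes eq) with delete-edges es u κ (restore (label κ) inv eq)
        ... | F″ , L , bound with label L (e , false) Fin.≟ label L (e , true)
        ... | yes glue = F″ , delete-glued e∉es L glue , (begin
          F + 2 * K                            ≤⟨ bound ⟩
          F″ + length es + 2 * C               ≤⟨ +-monoˡ-≤ (2 * C) (+-monoʳ-≤ F″ (n≤1+n _)) ⟩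
          F″ + suc (length es) + 2 * C         ∎)
        split K κ inv (yes eq) | zero   , L , bound | no ne = contradiction (label L (e , false)) λ ()
        split K κ inv (yes eq) | suc F′ , L , bound | no ne = F′ , delete-merge e∉es L ne , (begin
          F + 2 * K                            ≤⟨ bound ⟩
          suc F′ + length es + 2 * C           ≡⟨ cong (_+ 2 * C) (+-suc F′ (length es)) ⟨
          F′ + suc (length es) + 2 * C         ∎)
        split zero    κ inv (no ne) = contradiction (label κ (e , false)) λ ()
        split (suc K) κ inv (no ne) with merge (label κ (e , false)) (label κ (e , true)) ne
        ... | μ , μ-surj , μ-eq with delete-edges es u merged (restore (μ ∘ label κ) (λ x → cong μ (inv x)) μ-eq)
          where
          merged : Labelling σ K
          merged = record
            { label      = μ ∘ label κ
            ; surjective = λ y → let z , eq = μ-surj y ; x , eq′ = surjective κ z in x , trans (cong μ eq′) eq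
            ; invariant  = λ x → cong μ (invariant κ x) }
        ... | F″ , L , bound = suc F″ ,
          delete-split e∉es L (label κ) (λ x → trans (invariant κ _) (inv x)) ne , (begin
            F + 2 * suc K                        ≡⟨ solve 2 (λ f k → f :+ con 2 :* (con 1 :+ k) := con 2 :+ (f :+ con 2 :* k)) refl F K ⟩
            2 + (F + 2 * K)                      ≤⟨ +-monoʳ-≤ 2 bound ⟩
            2 + (F″ + length es + 2 * C)         ≡⟨ solve 3 (λ f l c → con 2 :+ (f :+ l :+ con 2 :* c) := con 1 :+ f :+ (con 1 :+ l) :+ con 2 :* c) refl F″ (length es) C ⟩
            suc F″ + suc (length es) + 2 * C     ∎)

-- Splicing elements out of a permutation

module Bypass {A : Set} (_≟_ : DecidableEquality A) where

  swap : A → A → A → A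
  swap a b x with x ≟ a | x ≟ b
  ... | yes _ | _     = b
  ... | no  _ | yes _ = a
  ... | no  _ | no  _ = x

  swap-left : ∀ {a} b → swap a b a ≡ b
  swap-left {a} b with a ≟ a | a ≟ b
  ... | yes _  | _ = refl
  ... | no a≢a | _ = contradiction refl a≢a

  swap-right : ∀ a {b} → swap a b b ≡ a
  swap-right a {b} with b ≟ a | b ≟ b
  ... | yes b≡a | _      = b≡a
  ... | no _    | yes _  = refl
  ... | no _    | no b≢b = contradiction refl b≢b

  swap-other : ∀ {a b x} → x ≢ a → x ≢ b → swap a b x ≡ x
  swap-other {a} {b} {x} x≢a x≢b with x ≟ a | x ≟ b
  ... | yes x≡a | _       = contradiction x≡a x≢a
  ... | no _    | yes x≡b = contradiction x≡b x≢b
  ... | no _    | no _    = refl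

  swap-involutive : ∀ a b x → swap a b (swap a b x) ≡ x
  swap-involutive a b x with x ≟ a | x ≟ b
  ... | yes x≡a | _       = trans (swap-right a) (sym x≡a)
  ... | no _    | yes x≡b = trans (swap-left b) (sym x≡b)
  ... | no x≢a  | no x≢b  = swap-other x≢a x≢b

  -- Removes d from its cycle of τ, leaving it as a fixed point.
  skip : A → (A → A) → A → A
  skip d τ x = swap d (τ d) (τ x)

  skip-fixed : ∀ d τ → skip d τ d ≡ d
  skip-fixed d τ = swap-right d

  skip-injective : ∀ {d τ} → Injective _≡_ _≡_ τ → Injective _≡_ _≡_ (skip d τ)
  skip-injective {d} {τ} inj {x} {y} eq = inj (trans (sym (swap-involutive d (τ d) (τ x)))
    (trans (cong (swap d (τ d)) eq) (swap-involutive d (τ d) (τ y))))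

  -- The swap only exchanges two elements with equal label. It is applied both to tails and to face
  -- labels, so splicing respects vertices as well as faces.
  skip-label : {B : Set} (ℓ : A → B) → ∀ {d τ} → ℓ (τ d) ≡ ℓ d → ∀ x → ℓ (skip d τ x) ≡ ℓ (τ x)
  skip-label ℓ {d} {τ} eq x with τ x ≟ d | τ x ≟ τ d
  ... | yes τx≡d | _         = trans eq (cong ℓ (sym τx≡d))
  ... | no _     | yes τx≡τd = trans (sym eq) (cong ℓ (sym τx≡τd))
  ... | no _     | no _      = refl

  skip-orbit : ∀ {d τ} → Injective _≡_ _≡_ τ → ∀ {x y} → x ≢ d → y ≢ d → SameOrbit τ x y → SameOrbit (skip d τ) x y
  skip-orbit {d} {τ} inj x≢d y≢d path =
    subst₂ (SameOrbit (skip d τ)) (push-other x≢d) (push-other y≢d)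
      (Eq.gfold (Eq.isEquivalence _) push step path)
    where
    -- The removed element is represented by its successor, so a step into or out of `d` becomes a
    -- step of the shortened cycle or no step at all.
    push : A → A
    push x with x ≟ d
    ... | yes _ = τ d
    ... | no  _ = x
    push-other : ∀ {x} → x ≢ d → push x ≡ x
    push-other {x} x≢d with x ≟ d
    ... | yes x≡d = contradiction x≡d x≢d
    ... | no _    = refl
    step : ∀ {x y} → τ x ≡ y → SameOrbit (skip d τ) (push x) (push y)
    step {x} refl with x ≟ d | τ x ≟ d
    ... | yes refl | yes τd≡d = ε
    ... | yes refl | no _     = ε
    ... | no x≢d   | yes τx≡d = fwd (trans (cong (swap d (τ d)) τx≡d) (swap-left (τ d))) ◅ ε
    ... | no x≢d   | no τx≢d  = fwd (swap-other τx≢d (x≢d ∘ inj)) ◅ ε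

  bypass : List A → (A → A) → A → A
  bypass []       τ = τ
  bypass (d ∷ ds) τ = skip d (bypass ds τ)

  bypass-injective : ∀ ds {τ} → Injective _≡_ _≡_ τ → Injective _≡_ _≡_ (bypass ds τ)
  bypass-injective []       inj = inj
  bypass-injective (d ∷ ds) inj = skip-injective (bypass-injective ds inj)

  bypass-label : {B : Set} (ℓ : A → B) (ds : List A) → ∀ {τ} → (∀ {d} → d ∈ ds → ℓ (τ d) ≡ ℓ d) →
    ∀ x → ℓ (bypass ds τ x) ≡ ℓ (τ x)
  bypass-label ℓ []       eq x = refl
  bypass-label ℓ (d ∷ ds) eq x =
    trans (skip-label ℓ (trans (bypass-label ℓ ds (eq ∘ there) d) (eq (here refl))) x)
          (bypass-label ℓ ds (eq ∘ there) x)

  bypass-fixed : ∀ ds {τ d} → Injective _≡_ _≡_ τ → d ∈ ds → bypass ds τ d ≡ d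
  bypass-fixed (d ∷ ds) {τ} inj (here refl) = skip-fixed d (bypass ds τ)
  bypass-fixed (c ∷ ds) {τ} {d} inj (there d∈) with d ≟ c
  ... | yes refl = skip-fixed c (bypass ds τ)
  ... | no d≢c   = trans (cong (swap c (bypass ds τ c)) fixed)
    (swap-other d≢c λ d≡τc → d≢c (bypass-injective ds inj (trans fixed d≡τc)))
    where
    fixed : bypass ds τ d ≡ d
    fixed = bypass-fixed ds inj d∈

  bypass-orbit : ∀ ds {τ} → Injective _≡_ _≡_ τ → ∀ {x y} → x ∉ ds → y ∉ ds →
    SameOrbit τ x y → SameOrbit (bypass ds τ) x y
  bypass-orbit []       inj x∉ y∉ path = path
  bypass-orbit (d ∷ ds) inj x∉ y∉ path = skip-orbit (bypass-injective ds inj)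
    (x∉ ∘ here) (y∉ ∘ here) (bypass-orbit ds inj (x∉ ∘ there) (y∉ ∘ there) path)

-- Discharging

path : {A : Set} → (A → A) → ℕ → A → List A
path f zero    x = []
path f (suc k) x = x ∷ path f k (f x)

module _ {A : Set} (f : A → A) where

  path-All : (P : A → Set) → (∀ {x} → P x → P (f x)) → ∀ k {x y} → P x → y ∈ path f k x → P y
  path-All P step (suc k) px (here refl) = px
  path-All P step (suc k) px (there y∈)  = path-All P step k (step px) y∈

  ∈-path : ∀ k {x y} → y ∈ path f k x → ∃[ j ] (j < k × y ≡ iter f j x)
  ∈-path (suc k) (here eq)  = 0 , s≤s z≤n , eq
  ∈-path (suc k) (there y∈) = let j , j<k , eq = ∈-path k y∈ in suc j , s≤s j<k , eq

  iter-comm : ∀ k x → iter f k (f x) ≡ f (iter f k x)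
  iter-comm zero    x = refl
  iter-comm (suc k) x = iter-comm k (f x)

  path-unique : Injective _≡_ _≡_ f → ∀ k {x} → (∀ j → suc j < k → iter f (suc j) x ≢ x) → Unique (path f k x)
  path-unique inj zero    _ = []
  path-unique inj (suc k) {x} return =
    All.tabulate (λ y∈ x≡y → let j , j<k , eq = ∈-path k y∈ in return j (s≤s j<k) (sym (trans x≡y eq))) ∷
    path-unique inj k λ j j<k eq → return j (m≤n⇒m≤1+n j<k) (inj (trans (sym (iter-comm (suc j) x)) eq))

index-lookup : {A : Set} {xs : List A} → Unique xs → ∀ j (p : lookup xs j ∈ xs) → Any.index p ≡ j
index-lookup (_ ∷ _)  zero    (here _)   = refl
index-lookup (x# ∷ _) zero    (there p)  = contradiction refl (All.lookup x# p)
index-lookup (x# ∷ _) (suc j) (here eq)  = contradiction (sym eq) (All.lookup x# (∈-lookup j))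
index-lookup (_ ∷ u)  (suc j) (there p)  = cong suc (index-lookup u j p)

both : ∀ {m} → List (Fin m) → List (D m)
both []       = []
both (i ∷ is) = (i , false) ∷ (i , true) ∷ both is

∈-both⁺ : ∀ {m} {is : List (Fin m)} {x} → proj₁ x ∈ is → x ∈ both is
∈-both⁺ {x = _ , false} (here refl) = here refl
∈-both⁺ {x = _ , true}  (here refl) = there (here refl)
∈-both⁺ (there i∈) = there (there (∈-both⁺ i∈))

∈-both⁻ : ∀ {m} {is : List (Fin m)} {x} → x ∈ both is → proj₁ x ∈ is
∈-both⁻ {is = i ∷ is} (here refl)         = here refl
∈-both⁻ {is = i ∷ is} (there (here refl)) = here refl
∈-both⁻ {is = i ∷ is} (there (there x∈))  = there (∈-both⁻ x∈)

-- The planar graph on numbered darts, with the hypotheses on cycles restated for closed walks of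
-- darts. `faces` bounds the number of faces from below and `components` that of components from
-- above, the directions that the deletion argument uses.
record PlaneMap (n m : ℕ) : Set where
  open Darts {m} public
  field
    σ           : D m → D m
    σ-injective : Injective _≡_ _≡_ σ
    tl          : D m → Fin n
    tl-σ        : ∀ x → tl (σ x) ≡ tl x
    cyclic      : ∀ {x y} → tl x ≡ tl y → SameOrbit σ x y
    loopless    : ∀ x → tl x ≢ tl (rev x)
    simple      : ∀ {x y} → tl x ≡ tl y → tl (rev x) ≡ tl (rev y) → x ≡ y

  hd : D m → Fin n
  hd x = tl (rev x)

  Closed₃ : D m → D m → D m → Set
  Closed₃ x y z = hd x ≡ tl y × hd y ≡ tl z × hd z ≡ tl x

  -- Consecutive tails differ because there are no loops; distinct diagonals make the walk a genuine
  -- 4-cycle.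
  Closed₄ : D m → D m → D m → D m → Set
  Closed₄ x y z t = hd x ≡ tl y × hd y ≡ tl z × hd z ≡ tl t × hd t ≡ tl x × tl x ≢ tl z × tl y ≢ tl t

  field
    V F C      : ℕ
    rep        : Fin V → D m
    cls        : D m → Fin V
    rep-unique : ∀ {i j} → tl (rep i) ≡ tl (rep j) → i ≡ j
    rep-cls    : ∀ x → tl (rep (cls x)) ≡ tl x
    faces      : Labelling (σ ∘ rev) F
    components : ∀ {K} (κ : Labelling σ K) → (∀ x → label κ (rev x) ≡ label κ x) → K ≤ C
    euler      : V + F ≡ m + 2 * C
    triangles  : ∀ {x y z x′ y′ z′} → Closed₃ x y z → Closed₃ x′ y′ z′ → tl x ≡ tl x′ →
                 (tl y ≡ tl y′ × tl z ≡ tl z′) ⊎ (tl y ≡ tl z′ × tl z ≡ tl y′)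
    -- The 4-cycles across `x` and `y` coincide, so the first contains the edge of `y`. Its
    -- neighbours of `tl y` are `tl x` and `tl p₃`, and `hd y` is not `tl x`.
    quads      : ∀ {x y z p₁ p₂ p₃ q₁ q₂ q₃} → Closed₃ x y z → Closed₄ (rev x) p₁ p₂ p₃ → Closed₄ (rev y) q₁ q₂ q₃ →
                 hd y ≡ tl p₃

module Sparse {n m : ℕ} (M : PlaneMap n m) where
  open PlaneMap M
  open Orientation (λ i b → tl (i , b)) using (Inside; inside?)

  hd-rev : ∀ x → hd (rev x) ≡ tl x
  hd-rev x = cong tl (rev-involutive x)

  simple-rev : ∀ {x y} → tl x ≡ hd y → hd x ≡ tl y → x ≡ rev y
  simple-rev {x} {y} p q = simple p (trans q (sym (hd-rev y)))

  module Restrict (S : List (Fin n)) where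

    Real : D m → Set
    Real x = Inside S (proj₁ x)

    real? : ∀ x → Dec (Real x)
    real? x = inside? S (proj₁ x)

    Real⇒tl∈S : ∀ {x} → Real x → tl x ∈ S
    Real⇒tl∈S {_ , false} (p , _) = p
    Real⇒tl∈S {_ , true}  (_ , q) = q

    kept cut : List (Fin m)
    kept = filter (inside? S) (allFin m)
    cut  = filter (¬? ∘ inside? S) (allFin m)

    ∉cut : ∀ {x} → Real x → proj₁ x ∉ cut
    ∉cut r i∈ = proj₂ (∈-filter⁻ (¬? ∘ inside? S) {xs = allFin m} i∈) r

    ∈cut : ∀ {x} → ¬ Real x → proj₁ x ∈ cut
    ∈cut ¬r = ∈-filter⁺ (¬? ∘ inside? S) (∈-allFin _) ¬r

    -- The faces of `σ ∘ α cut` also run through dangling darts, so their lengths mean nothing for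
    -- G[S]. Here the dangling darts are fixed points, and on real darts `φ` walks around the faces
    -- of G[S].
    σᴿ φ : D m → D m
    σᴿ = Bypass.bypass _≟ᴰ_ (both cut) σ
    φ  = σᴿ ∘ rev

    σᴿ-injective : Injective _≡_ _≡_ σᴿ
    σᴿ-injective = Bypass.bypass-injective _≟ᴰ_ (both cut) σ-injective

    φ-injective : Injective _≡_ _≡_ φ
    φ-injective = rev-injective ∘ σᴿ-injective

    -- An image outside G[S] would be a fixed point of `σᴿ`, hence by injectivity equal to `x`.
    σᴿ-real : ∀ {x} → Real x → Real (σᴿ x)
    σᴿ-real {x} r = decidable-stable (real? (σᴿ x)) λ ¬r →
      ¬r (subst Real (sym (σᴿ-injective (Bypass.bypass-fixed _≟ᴰ_ (both cut) σ-injective (∈-both⁺ (∈cut {σᴿ x} ¬r))))) r)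

    φ-real : ∀ {x} → Real x → Real (φ x)
    φ-real r = σᴿ-real r

    tl-σᴿ : ∀ x → tl (σᴿ x) ≡ tl x
    tl-σᴿ x = trans (Bypass.bypass-label _≟ᴰ_ tl (both cut) (λ {d} _ → tl-σ d) x) (tl-σ x)

    tl-φ : ∀ x → tl (φ x) ≡ hd x
    tl-φ x = tl-σᴿ (rev x)

    σᴿ-cyclic : ∀ {x y} → Real x → Real y → tl x ≡ tl y → SameOrbit σᴿ x y
    σᴿ-cyclic {x} {y} rx ry eq = Bypass.bypass-orbit _≟ᴰ_ (both cut) σ-injective (∉cut {x} rx ∘ ∈-both⁻) (∉cut {y} ry ∘ ∈-both⁻) (cyclic eq)

    short-orbit : ∀ {x y} → σᴿ (σᴿ x) ≡ x → Real x → Real y → tl x ≡ tl y → y ≡ x ⊎ y ≡ σᴿ x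
    short-orbit {x} back rx ry eq = go (inj₁ refl) (σᴿ-cyclic rx ry eq)
      where
      go : ∀ {z y} → z ≡ x ⊎ z ≡ σᴿ x → SameOrbit σᴿ z y → y ≡ x ⊎ y ≡ σᴿ x
      go p ε = p
      go (inj₁ refl) (fwd refl ◅ rest) = go (inj₂ refl) rest
      go (inj₂ refl) (fwd refl ◅ rest) = go (inj₁ back) rest
      go (inj₁ refl) (bwd eq ◅ rest)   = go (inj₂ (σᴿ-injective (trans eq (sym back)))) rest
      go (inj₂ refl) (bwd eq ◅ rest)   = go (inj₁ (σᴿ-injective eq)) rest

    -- `turn` excludes degree 1 together with degree 2, as a fixed point of `σᴿ` is also fixed by
    -- its square.
    module MinDegree₃
      (turn : ∀ {x} → Real x → σᴿ (σᴿ x) ≢ x)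
      where

      no-back : ∀ {x} → Real x → φ x ≢ rev x
      no-back {x} r eq = turn {rev x} r (trans (cong σᴿ eq) eq)

      return₁ : ∀ x → φ x ≢ x
      return₁ x eq = loopless x (trans (cong tl (sym eq)) (tl-φ x))

      -- In a simple graph, a face walk that is back after two steps has run back along the same
      -- edge, which needs a vertex of degree 1.
      diagonal : ∀ {x} → Real x → tl x ≢ tl (φ (φ x))
      diagonal {x} r eq = no-back r (simple-rev (tl-φ x) (trans (sym (tl-φ (φ x))) (sym eq)))

      return₂ : ∀ {x} → Real x → φ (φ x) ≢ x
      return₂ r eq = diagonal r (cong tl (sym eq))

      Tri Quad : D m → Set
      Tri x  = φ (φ (φ x)) ≡ x
      Quad x = φ (φ (φ (φ x))) ≡ x

      tri? : ∀ x → Dec (Tri x)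
      tri? x = φ (φ (φ x)) ≟ᴰ x

      quad? : ∀ x → Dec (Quad x)
      quad? x = φ (φ (φ (φ x))) ≟ᴰ x

      tri-closed : ∀ {x} → Tri x → Closed₃ x (φ x) (φ (φ x))
      tri-closed {x} t = sym (tl-φ x) , sym (tl-φ (φ x)) , trans (sym (tl-φ (φ (φ x)))) (cong tl t)

      quad-closed : ∀ {x} → Real x → Quad x → Closed₄ x (φ x) (φ (φ x)) (φ (φ (φ x)))
      quad-closed {x} r q = sym (tl-φ x) , sym (tl-φ (φ x)) , sym (tl-φ (φ (φ x))) ,
        trans (sym (tl-φ (φ (φ (φ x))))) (cong tl q) , diagonal r , diagonal (φ-real r)

      rotate : ∀ {x y z} → Closed₃ x y z → Closed₃ y z x
      rotate (p , q , r) = q , r , p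

      -- Otherwise the end of x would have degree 2.
      pinch : ∀ {x} → Real x → φ (rev (φ x)) ≢ rev x
      pinch {x} r eq = turn {rev x} r (trans (cong σᴿ (sym (rev-involutive (φ x)))) eq)

      -- The two triangles share the end of `x`, so they are the same triangle. Traversed in the
      -- same sense, they make the end of `x` a vertex of degree 2; in the opposite sense, `φ x`
      -- would be `rev x`.
      tri-apart : ∀ {x} → Real x → Tri (rev x) → ¬ Tri (rev (φ x))
      tri-apart {x} r s t with triangles (tri-closed s) (rotate (tri-closed t)) start
        where
        start : tl (rev x) ≡ tl (φ (rev (φ x)))
        start = sym (trans (tl-φ _) (trans (hd-rev (φ x)) (tl-φ x)))
      ... | inj₁ (_ , eq) = pinch r (trans (cong φ (sym same)) s)
        where
        same : φ (φ (rev x)) ≡ rev (φ x)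
        same = simple eq (trans (proj₂ (proj₂ (tri-closed s))) (sym (trans (hd-rev (φ x)) (tl-φ x))))
      ... | inj₂ (eq , _) = no-back r (simple-rev (tl-φ x) (sym (trans (sym (trans (tl-φ _) (hd-rev x))) eq)))

      -- Both faces would be bounded by one triangle, and the rotation at the tail of `x` would
      -- close after two steps.
      tri-rev : ∀ {x} → Real x → Tri x → ¬ Tri (rev x)
      tri-rev {x} r s t with triangles (tri-closed s) (rotate (tri-closed t)) (sym (trans (tl-φ _) (hd-rev x)))
      ... | inj₁ (_ , eq) = loopless (φ x) (trans (tl-φ x) (trans (sym eq) (tl-φ (φ x))))
      ... | inj₂ (_ , eq) = turn r (trans (cong σᴿ same) s)
        where
        same : σᴿ x ≡ rev (φ (φ x))
        same = simple-rev (trans (tl-σᴿ x) (sym (proj₂ (proj₂ (tri-closed s)))))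
          (trans (cong (tl ∘ rev ∘ σᴿ) (sym (rev-involutive x))) (trans (sym (tl-φ (φ (rev x)))) (sym eq)))

      -- Both 4-faces would be bounded by the only 4-cycle adjacent to the triangle. The face across
      -- `x` then also passes along `rev (φ x)` just before `rev x`, leaving no third edge at their
      -- common vertex.
      tri-quad : ∀ {x} → Real x → Tri x → Quad (rev x) → ¬ Quad (rev (φ x))
      tri-quad {x} r s p q = pinch r (trans (cong φ (sym same)) p)
        where
        meet : hd (φ x) ≡ tl (φ (φ (φ (rev x))))
        meet = quads (tri-closed s) (quad-closed r p) (quad-closed (φ-real r) q)
        same : φ (φ (φ (rev x))) ≡ rev (φ x)
        same = simple-rev (sym meet)
          (trans (proj₁ (proj₂ (proj₂ (proj₂ (quad-closed r p))))) (sym (tl-φ x)))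

      -- Discharging in half-units: a dart starts with 2, and a triangle takes 1 across
      -- each edge whose other side is a face of length at least 5.
      charge : {A B A′ B′ : Set} → Dec A → Dec B → Dec A′ → Dec B′ → ℕ
      charge (yes _) _       (yes _) _       = 2
      charge (yes _) _       (no _)  (yes _) = 2
      charge (yes _) _       (no _)  (no _)  = 3
      charge (no _)  (yes _) _       _       = 2
      charge (no _)  (no _)  (yes _) _       = 1
      charge (no _)  (no _)  (no _)  _       = 2

      charge-balanced : {A B A′ B′ : Set} (a : Dec A) (b : Dec B) (a′ : Dec A′) (b′ : Dec B′) →
        charge a b a′ b′ + charge a′ b′ a b ≡ 4
      charge-balanced (yes _) _       (yes _) _       = refl
      charge-balanced (yes _) _       (no _)  (yes _) = refl
      charge-balanced (yes _) _       (no _)  (no _)  = refl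
      charge-balanced (no _)  (yes _) (yes _) _       = refl
      charge-balanced (no _)  (yes _) (no _)  (yes _) = refl
      charge-balanced (no _)  (yes _) (no _)  (no _)  = refl
      charge-balanced (no _)  (no _)  (yes _) _       = refl
      charge-balanced (no _)  (no _)  (no _)  (yes _) = refl
      charge-balanced (no _)  (no _)  (no _)  (no _)  = refl

      charge≥1 : {A B A′ B′ : Set} (a : Dec A) (b : Dec B) (a′ : Dec A′) (b′ : Dec B′) → 1 ≤ charge a b a′ b′
      charge≥1 (yes _) _       (yes _) _       = s≤s z≤n
      charge≥1 (yes _) _       (no _)  (yes _) = s≤s z≤n
      charge≥1 (yes _) _       (no _)  (no _)  = s≤s z≤n
      charge≥1 (no _)  (yes _) _       _       = s≤s z≤n
      charge≥1 (no _)  (no _)  (yes _) _       = s≤s z≤n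
      charge≥1 (no _)  (no _)  (no _)  _       = s≤s z≤n

      charge≥2 : {A B A′ B′ : Set} (a : Dec A) (b : Dec B) (a′ : Dec A′) (b′ : Dec B′) →
        A ⊎ B ⊎ ¬ A′ → 2 ≤ charge a b a′ b′
      charge≥2 (yes _) _       (yes _) _       _ = s≤s (s≤s z≤n)
      charge≥2 (yes _) _       (no _)  (yes _) _ = s≤s (s≤s z≤n)
      charge≥2 (yes _) _       (no _)  (no _)  _ = s≤s (s≤s z≤n)
      charge≥2 (no _)  (yes _) _       _       _ = s≤s (s≤s z≤n)
      charge≥2 (no _)  (no _)  (no _)  _       _ = s≤s (s≤s z≤n)
      charge≥2 (no ¬a) (no _)  (yes _) _ (inj₁ a)          = contradiction a ¬a
      charge≥2 (no _)  (no ¬b) (yes _) _ (inj₂ (inj₁ b))   = contradiction b ¬b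
      charge≥2 (no _)  (no _)  (yes a) _ (inj₂ (inj₂ ¬a))  = contradiction a ¬a

      charge≥3 : {A B A′ B′ : Set} (a : Dec A) (b : Dec B) (a′ : Dec A′) (b′ : Dec B′) →
        A → ¬ A′ → ¬ B′ → 3 ≤ charge a b a′ b′
      charge≥3 (yes _) _ (no _)  (no _)  _ _ _ = s≤s (s≤s (s≤s z≤n))
      charge≥3 (yes _) _ (no _)  (yes b) _ _ ¬b = contradiction b ¬b
      charge≥3 (yes _) _ (yes a) _       _ ¬a _ = contradiction a ¬a
      charge≥3 (no ¬a) _ _       _       a _ _ = contradiction a ¬a

      weight : D m → ℕ
      weight x with real? x
      ... | yes _ = charge (tri? x) (quad? x) (tri? (rev x)) (quad? (rev x))
      -- A vertex outside `S` keeps only dangling darts, which form a face of their own; its single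
      -- representative has to supply the full 8.
      ... | no  _ = 8

      weight-real : ∀ {x} → Real x → weight x ≡ charge (tri? x) (quad? x) (tri? (rev x)) (quad? (rev x))
      weight-real {x} r with real? x
      ... | yes _ = refl
      ... | no ¬r = contradiction r ¬r

      weight-cut : ∀ {x} → ¬ Real x → weight x ≡ 8
      weight-cut {x} ¬r with real? x
      ... | yes r = contradiction r ¬r
      ... | no _  = refl

      weight≥1 : ∀ {x} → Real x → 1 ≤ weight x
      weight≥1 {x} r = subst (1 ≤_) (sym (weight-real r)) (charge≥1 (tri? x) (quad? x) (tri? (rev x)) (quad? (rev x)))

      weight≥2 : ∀ {x} → Real x → Tri x ⊎ Quad x ⊎ ¬ Tri (rev x) → 2 ≤ weight x
      weight≥2 {x} r p = subst (2 ≤_) (sym (weight-real r)) (charge≥2 (tri? x) (quad? x) (tri? (rev x)) (quad? (rev x)) p)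

      weight≥3 : ∀ {x} → Real x → Tri x → ¬ Quad (rev x) → 3 ≤ weight x
      weight≥3 {x} r t ¬q = subst (3 ≤_) (sym (weight-real r))
        (charge≥3 (tri? x) (quad? x) (tri? (rev x)) (quad? (rev x)) t (tri-rev r t) ¬q)

      -- By `tri-apart`, at most one of two consecutive darts gives something to a triangle: at
      -- worst 1 + 2.
      weight-pair : ∀ {x} → Real x → 3 ≤ weight x + weight (φ x)
      weight-pair {x} r with tri? (rev x)
      ... | yes t = +-mono-≤ (weight≥1 r) (weight≥2 (φ-real r) (inj₂ (inj₂ (tri-apart r t))))
      ... | no ¬t = +-mono-≤ (weight≥2 r (inj₂ (inj₂ ¬t))) (weight≥1 (φ-real r))

      -- The threshold 8 is average length 4 at 2 per dart. Weights being nonnegative, a stretch of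
      -- the face is enough; for length 6 or more, six darts already carry 3 + 3 + 3.
      HeavyPath : D m → Set
      HeavyPath x = ∃[ k ] (Unique (path φ k x) × 8 ≤ sum (map weight (path φ k x)))

      heavy-tri : ∀ {x} → Real x → Tri x → HeavyPath x
      heavy-tri {x} r t = 3 , path-unique φ φ-injective 3 return , heavy
        where
        return : ∀ j → suc j < 3 → iter φ (suc j) x ≢ x
        return 0 _ = return₁ x
        return 1 _ = return₂ r
        return (suc (suc _)) (s≤s (s≤s (s≤s ())))
        r₁ : Real (φ x)
        r₁ = φ-real r
        r₂ : Real (φ (φ x))
        r₂ = φ-real r₁
        t₁ : Tri (φ x)
        t₁ = cong φ t
        t₂ : Tri (φ (φ x))
        t₂ = cong φ t₁
        heavy : 8 ≤ weight x + (weight (φ x) + (weight (φ (φ x)) + 0))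
        -- By `tri-quad`, at most one of the three edges borders a 4-face; the other two each
        -- receive one unit, giving 2 + 3 + 3.
        heavy with quad? (rev x) | quad? (rev (φ x))
        ... | yes q | _ = +-mono-≤ (weight≥2 r (inj₁ t)) (+-mono-≤ (weight≥3 r₁ t₁ (tri-quad r t q))
              (+-mono-≤ (weight≥3 r₂ t₂ λ q₂ → tri-quad r₂ t₂ q₂ (subst (Quad ∘ rev) (sym t) q)) z≤n))
        ... | no ¬q | yes q₁ = +-mono-≤ (weight≥3 r t ¬q) (+-mono-≤ (weight≥2 r₁ (inj₁ t₁))
              (+-mono-≤ (weight≥3 r₂ t₂ (tri-quad r₁ t₁ q₁)) z≤n))
        ... | no ¬q | no ¬q₁ = +-mono-≤ (weight≥3 r t ¬q) (+-mono-≤ (weight≥3 r₁ t₁ ¬q₁)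
              (+-mono-≤ (weight≥2 r₂ (inj₁ t₂)) z≤n))

      heavy-quad : ∀ {x} → Real x → ¬ Tri x → Quad x → HeavyPath x
      heavy-quad {x} r ¬t q = 4 , path-unique φ φ-injective 4 return ,
        +-mono-≤ (weight≥2 r (inj₂ (inj₁ q)))
        (+-mono-≤ (weight≥2 (φ-real r) (inj₂ (inj₁ (cong φ q))))
        (+-mono-≤ (weight≥2 (φ-real (φ-real r)) (inj₂ (inj₁ (cong (φ ∘ φ) q))))
        (+-mono-≤ (weight≥2 (φ-real (φ-real (φ-real r))) (inj₂ (inj₁ (cong (φ ∘ φ ∘ φ) q)))) z≤n)))
        where
        return : ∀ j → suc j < 4 → iter φ (suc j) x ≢ x
        return 0 _ = return₁ x
        return 1 _ = return₂ r
        return 2 _ = ¬t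
        return (suc (suc (suc _))) (s≤s (s≤s (s≤s (s≤s ()))))

      heavy-pent : ∀ {x} → Real x → ¬ Tri x → ¬ Quad x → iter φ 5 x ≡ x → HeavyPath x
      heavy-pent {x} r ¬t ¬q p = 5 , path-unique φ φ-injective 5 return , heavy (tri? (rev x))
        where
        return : ∀ j → suc j < 5 → iter φ (suc j) x ≢ x
        return 0 _ = return₁ x
        return 1 _ = return₂ r
        return 2 _ = ¬t
        return 3 _ = ¬q
        return (suc (suc (suc (suc _)))) (s≤s (s≤s (s≤s (s≤s (s≤s ())))))
        x₁ x₂ x₃ x₄ : D m
        x₁ = φ x
        x₂ = φ x₁
        x₃ = φ x₂
        x₄ = φ x₃
        r₁ : Real x₁
        r₁ = φ-real r
        r₂ : Real x₂
        r₂ = φ-real r₁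
        r₃ : Real x₃
        r₃ = φ-real r₂
        r₄ : Real x₄
        r₄ = φ-real r₃
        -- If `x` gives, its two neighbours `x₁` and `x₄` on the face do not, and `x₂`, `x₃` form a
        -- pair. If `x` keeps its 2, the other four darts form two pairs.
        heavy : Dec (Tri (rev x)) → 8 ≤ weight x + (weight x₁ + (weight x₂ + (weight x₃ + (weight x₄ + 0))))
        heavy (no ¬s) = begin
          2 + (3 + 3)                                                        ≤⟨ +-mono-≤ (weight≥2 r (inj₂ (inj₂ ¬s))) (+-mono-≤ (weight-pair r₁) (weight-pair r₃)) ⟩
          weight x + ((weight x₁ + weight x₂) + (weight x₃ + weight x₄))     ≡⟨ solve 5 (λ a b c d e → a :+ ((b :+ c) :+ (d :+ e)) := a :+ (b :+ (c :+ (d :+ (e :+ con 0))))) refl (weight x) (weight x₁) (weight x₂) (weight x₃) (weight x₄) ⟩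
          weight x + (weight x₁ + (weight x₂ + (weight x₃ + (weight x₄ + 0)))) ∎
          where open ≤-Reasoning
        heavy (yes s) = begin
          1 + (2 + (3 + 2))                                                  ≤⟨ +-mono-≤ (weight≥1 r) (+-mono-≤ (weight≥2 r₁ (inj₂ (inj₂ (tri-apart r s)))) (+-mono-≤ (weight-pair r₂) (weight≥2 r₄ (inj₂ (inj₂ λ s₄ → tri-apart r₄ s₄ (subst (Tri ∘ rev) (sym p) s)))))) ⟩
          weight x + (weight x₁ + ((weight x₂ + weight x₃) + weight x₄))     ≡⟨ solve 5 (λ a b c d e → a :+ (b :+ ((c :+ d) :+ e)) := a :+ (b :+ (c :+ (d :+ (e :+ con 0))))) refl (weight x) (weight x₁) (weight x₂) (weight x₃) (weight x₄) ⟩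
          weight x + (weight x₁ + (weight x₂ + (weight x₃ + (weight x₄ + 0)))) ∎
          where open ≤-Reasoning

      heavy-long : ∀ {x} → Real x → ¬ Tri x → ¬ Quad x → iter φ 5 x ≢ x → HeavyPath x
      heavy-long {x} r ¬t ¬q ¬p = 6 , path-unique φ φ-injective 6 return , (begin
        8                                                                ≤⟨ n≤1+n 8 ⟩
        3 + (3 + 3)                                                      ≤⟨ +-mono-≤ (weight-pair r) (+-mono-≤ (weight-pair r₂) (weight-pair (φ-real (φ-real r₂)))) ⟩
        (w 0 + w 1) + ((w 2 + w 3) + (w 4 + w 5))                        ≡⟨ solve 6 (λ a b c d e f → (a :+ b) :+ ((c :+ d) :+ (e :+ f)) := a :+ (b :+ (c :+ (d :+ (e :+ (f :+ con 0)))))) refl (w 0) (w 1) (w 2) (w 3) (w 4) (w 5) ⟩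
        w 0 + (w 1 + (w 2 + (w 3 + (w 4 + (w 5 + 0)))))                  ∎)
        where
        open ≤-Reasoning
        w : ℕ → ℕ
        w j = weight (iter φ j x)
        r₂ : Real (φ (φ x))
        r₂ = φ-real (φ-real r)
        return : ∀ j → suc j < 6 → iter φ (suc j) x ≢ x
        return 0 _ = return₁ x
        return 1 _ = return₂ r
        return 2 _ = ¬t
        return 3 _ = ¬q
        return 4 _ = ¬p
        return (suc (suc (suc (suc (suc _))))) (s≤s (s≤s (s≤s (s≤s (s≤s (s≤s ()))))))

      heavy-path : ∀ {x} → Real x → HeavyPath x
      heavy-path {x} r with tri? x | quad? x | iter φ 5 x ≟ᴰ x
      ... | yes t | _     | _     = heavy-tri r t
      ... | no ¬t | yes q | _     = heavy-quad r ¬t q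
      ... | no ¬t | no ¬q | yes p = heavy-pent r ¬t ¬q p
      ... | no ¬t | no ¬q | no ¬p = heavy-long r ¬t ¬q ¬p

-- The edge bound for every set of vertices

any-Bool? : {P : Bool → Set} → (∀ b → Dec (P b)) → Dec (∃ P)
any-Bool? P? with P? false | P? true
... | yes p | _     = yes (false , p)
... | no _  | yes p = yes (true , p)
... | no ¬p | no ¬q = no λ { (false , p) → ¬p p ; (true , q) → ¬q q }

module SparseBound {n m : ℕ} (M : PlaneMap n m) where
  open PlaneMap M
  open Orientation (λ i b → tl (i , b)) using (Inside; inside?)
  open Sparse M

  module Euler (S : List (Fin n)) (unique : Unique S) where
    open Restrict S

    ts : List (Fin V)
    ts = filter (λ j → ¬? (tl (rep j) ∈? S)) (allFin V)

    ts-unique : Unique ts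
    ts-unique = filter⁺ (λ j → ¬? (tl (rep j) ∈? S)) (allFin⁺ V)

    ∈ts : ∀ {j} → tl (rep j) ∉ S → j ∈ ts
    ∈ts {j} = ∈-filter⁺ (λ j → ¬? (tl (rep j) ∈? S)) (∈-allFin j)

    ∈ts⁻ : ∀ {j} → j ∈ ts → tl (rep j) ∉ S
    ∈ts⁻ = proj₂ ∘ ∈-filter⁻ (λ j → ¬? (tl (rep j) ∈? S)) {xs = allFin V}

    V≤ : V ≤ length S + length ts
    V≤ = begin
      V                                    ≡⟨ length-tabulate id ⟨
      length (allFin V)                    ≡⟨ length-partition (λ j → tl (rep j) ∈? S) (allFin V) ⟩
      length ss + length ts                ≡⟨ cong (_+ length ts) (length-map (tl ∘ rep) ss) ⟨
      length (map (tl ∘ rep) ss) + length ts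
        ≤⟨ +-monoˡ-≤ (length ts) (length-⊆ (map⁺ rep-unique (filter⁺ (λ j → tl (rep j) ∈? S) (allFin⁺ V))) ⊆S) ⟩
      length S + length ts                 ∎
      where
      open ≤-Reasoning
      ss : List (Fin V)
      ss = filter (λ j → tl (rep j) ∈? S) (allFin V)
      ⊆S : ∀ {v} → v ∈ map (tl ∘ rep) ss → v ∈ S
      ⊆S v∈ with ∈-map⁻ (tl ∘ rep) v∈
      ... | j , j∈ , refl = proj₂ (∈-filter⁻ (λ j → tl (rep j) ∈? S) {xs = allFin V} j∈)

    cls-tl : ∀ {x y} → tl x ≡ tl y → cls x ≡ cls y
    cls-tl {x} {y} eq = rep-unique (trans (rep-cls x) (trans eq (sym (rep-cls y))))

    -- Each vertex outside S is a component by itself, and S counts as a single one.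
    position : Fin V → Fin (suc (length ts))
    position j with j ∈? ts
    ... | yes p = suc (Any.index p)
    ... | no  _ = zero

    position-S : ∀ {x} → tl x ∈ S → position (cls x) ≡ zero
    position-S {x} x∈S with cls x ∈? ts
    ... | yes p = contradiction (subst (_∈ S) (sym (rep-cls x)) x∈S) (∈ts⁻ p)
    ... | no  _ = refl

    position-lookup : ∀ j → position (lookup ts j) ≡ suc j
    position-lookup j with lookup ts j ∈? ts
    ... | yes p = cong suc (index-lookup ts-unique j p)
    ... | no ∉ts = contradiction (∈-lookup j) ∉ts

    -- The labels are a lower bound for the components left after cutting, which is what
    -- `delete-edges` asks for. The dart `x₀` is there so that the label `zero` of `S` is attained.
    pieces : ∀ {x₀} → Real x₀ → Labelling σ (suc (length ts))
    pieces {x₀} r = record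
      { label      = position ∘ cls
      ; surjective = surj
      ; invariant  = λ x → cong position (cls-tl (tl-σ x)) }
      where
      surj : StrictlySurjective _≡_ (position ∘ cls)
      surj zero    = x₀ , position-S (Real⇒tl∈S r)
      surj (suc j) = rep (lookup ts j) , trans (cong position (rep-unique (rep-cls _))) (position-lookup j)

    pieces-α : ∀ x → position (cls (α cut x)) ≡ position (cls x)
    pieces-α x with real? x
    ... | yes r = trans (cong (position ∘ cls) (α-∉ (∉cut {x} r)))
                        (trans (position-S (Real⇒tl∈S {rev x} r)) (sym (position-S (Real⇒tl∈S r))))
    ... | no ¬r = cong (position ∘ cls) (α-∈ (∈cut {x} ¬r))

    module _
      (turn : ∀ {x} → Real x → σᴿ (σᴿ x) ≢ x)
      (incident : ∀ {v} → v ∈ S → ∃[ x ] (Real x × tl x ≡ v))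
      where
      open MinDegree₃ turn

      items : List (D m)
      items = both kept ++ map rep ts

      weight-items : sum (map weight items) ≡ 4 * length kept + 8 * length ts
      weight-items = begin
        sum (map weight items)                                       ≡⟨ cong sum (map-++ weight (both kept) (map rep ts)) ⟩
        sum (map weight (both kept) ++ map weight (map rep ts))      ≡⟨ sum-++ (map weight (both kept)) _ ⟩
        sum (map weight (both kept)) + sum (map weight (map rep ts)) ≡⟨ cong₂ _+_ (inner kept (proj₂ ∘ ∈-filter⁻ (inside? S) {xs = allFin m})) (outer ts ∈ts⁻) ⟩
        4 * length kept + 8 * length ts                              ∎
        where
        open ≡-Reasoning
        inner : ∀ is → (∀ {i} → i ∈ is → Inside S i) → sum (map weight (both is)) ≡ 4 * length is
        inner []       _  = refl
        inner (i ∷ is) ok = begin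
          weight (i , false) + (weight (i , true) + sum (map weight (both is)))  ≡⟨ +-assoc (weight (i , false)) _ _ ⟨
          weight (i , false) + weight (i , true) + sum (map weight (both is))    ≡⟨ cong₂ _+_ pair (inner is (ok ∘ there)) ⟩
          4 + 4 * length is                                                      ≡⟨ *-suc 4 (length is) ⟨
          4 * suc (length is)                                                    ∎
          where
          pair : weight (i , false) + weight (i , true) ≡ 4
          pair = trans (cong₂ _+_ (weight-real (ok (here refl))) (weight-real (ok (here refl))))
            (charge-balanced (tri? (i , false)) (quad? (i , false)) (tri? (i , true)) (quad? (i , true)))
        outer : ∀ js → (∀ {j} → j ∈ js → tl (rep j) ∉ S) → sum (map weight (map rep js)) ≡ 8 * length js
        outer []       _  = refl
        outer (j ∷ js) ok = trans (cong₂ _+_ (weight-cut (ok (here refl) ∘ Real⇒tl∈S)) (outer js (ok ∘ there)))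
          (sym (*-suc 8 (length js)))

      module _ {F′ : ℕ} (L : Labelling (σ ∘ α cut) F′) where

        label-cut : ∀ {x} → ¬ Real x → label L (σ x) ≡ label L x
        label-cut {x} ¬r = trans (cong (label L ∘ σ) (sym (α-∈ (∈cut {x} ¬r)))) (invariant L x)

        -- At a dangling dart `σ ∘ α cut` acts as `σ`, so `σ` preserves face labels there and
        -- splicing such darts out stays within the face. Walks of `φ` can therefore be charged to
        -- the faces counted by `L`.
        label-φ : ∀ {x} → Real x → label L (φ x) ≡ label L x
        label-φ {x} r = trans
          (Bypass.bypass-label _≟ᴰ_ (label L) (both cut) (λ {d} d∈ → label-cut {d} λ r′ → ∉cut {d} r′ (∈-both⁻ d∈)) (rev x))
          (trans (cong (label L ∘ σ) (sym (α-∉ (∉cut {x} r)))) (invariant L x))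

        Fibre : Fin F′ → List (D m) → Set
        Fibre f xs = (Unique xs × (∀ {x} → x ∈ xs → x ∈ items × label L x ≡ f)) × 8 ≤ sum (map weight xs)

        forward : ∀ {x y} → tl x ≡ tl y → ∃[ k ] iter σ k x ≡ y
        forward eq = orbit⇒iter σ σ-injective code-injective (cyclic eq)

        -- All darts at a vertex outside `S` dangle, so the rotation around it is one face, and that
        -- face contains the representative.
        outside : ∀ {f x} → tl x ∉ S → label L x ≡ f → ∃[ xs ] Fibre f xs
        outside {f} {x} x∉S refl = rep (cls x) ∷ [] , (([] ∷ []) , λ { (here refl) → r∈ , same }) ,
          ≤-reflexive (sym (trans (+-identityʳ _) (weight-cut (r∉S ∘ Real⇒tl∈S))))
          where
          r∉S : tl (rep (cls x)) ∉ S
          r∉S = subst (_∉ S) (sym (rep-cls x)) x∉S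
          r∈ : rep (cls x) ∈ items
          r∈ = ∈-++⁺ʳ (both kept) (∈-map⁺ rep (∈ts r∉S))
          stay : ∀ k {y} → tl y ∉ S → label L (iter σ k y) ≡ label L y
          stay zero    _ = refl
          stay (suc k) {y} y∉S = trans (stay k (subst (_∉ S) (sym (tl-σ y)) y∉S)) (label-cut {y} (y∉S ∘ Real⇒tl∈S))
          same : label L (rep (cls x)) ≡ label L x
          same = let k , eq = forward (sym (rep-cls x)) in trans (cong (label L) (sym eq)) (stay k x∉S)

        -- Turning past a dangling dart does not leave the face, so every face at a vertex with a
        -- real dart contains a real dart.
        real-in-face : ∀ k {x y} → iter σ k x ≡ y → Real y → ∃[ z ] (Real z × label L z ≡ label L x)
        real-in-face zero    {x} refl r = x , r , refl
        real-in-face (suc k) {x} eq   r with real? x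
        ... | yes rx = x , rx , refl
        ... | no ¬rx = let z , rz , lz = real-in-face k eq r in z , rz , trans lz (label-cut {x} ¬rx)

        inner : ∀ {f x} → tl x ∈ S → label L x ≡ f → ∃[ xs ] Fibre f xs
        inner {f} {x} x∈S refl with incident x∈S
        ... | y , ry , ty with forward (sym ty)
        ... | k , eq with real-in-face k eq ry
        ... | z , rz , lz with heavy-path rz
        ... | j , u , heavy = path φ j z , (u , λ {t} t∈ →
              let rt , lt = path-All φ (λ t → Real t × label L t ≡ label L x)
                              (λ {t} (rt , lt) → φ-real {t} rt , trans (label-φ {t} rt) lt) j (rz , lz) t∈
              in ∈-++⁺ˡ (∈-both⁺ (∈-filter⁺ (inside? S) (∈-allFin (proj₁ t)) rt)) , lt) , heavy

        fibre : ∀ f → ∃[ xs ] Fibre f xs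
        fibre f with surjective L f
        ... | x , eq with tl x ∈? S
        ... | yes x∈S = inner x∈S eq
        ... | no x∉S  = outside x∉S eq

        -- Paths chosen for different face labels are disjoint, so their weights add up to at most
        -- the total of `items`.
        discharge : 8 * F′ ≤ 4 * length kept + 8 * length ts
        discharge = begin
          8 * F′                                                             ≡⟨ cong (8 *_) (length-tabulate {n = F′} id) ⟨
          8 * length (allFin F′)                                             ≡⟨ sum-const 8 (allFin F′) ⟨
          sum (map (λ _ → 8) (allFin F′))                                    ≤⟨ sum-mono (allFin F′) (λ {f} _ → proj₂ (proj₂ (fibre f))) ⟩
          sum (map (λ f → sum (map weight (proj₁ (fibre f)))) (allFin F′))   ≤⟨ sum-fibres (label L) weight items (proj₁ ∘ fibre) (allFin⁺ F′) (λ f _ → proj₁ (proj₂ (fibre f))) ⟩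
          sum (map weight items)                                             ≡⟨ weight-items ⟩
          4 * length kept + 8 * length ts                                    ∎
          where open ≤-Reasoning

      dense-bound : ∀ {x₀} → Real x₀ → length kept ≤ 2 * length S
      dense-bound {x₀} r with delete-edges σ σ-injective faces components cut (filter⁺ (¬? ∘ inside? S) (allFin⁺ m)) (pieces {x₀} r) pieces-α
      ... | F′ , L , bound = arith (length kept) (length cut) (length S) (length ts) F′ V F m C
              (trans (sym (length-tabulate id)) (length-partition (inside? S) (allFin m)))
              bound euler V≤ (discharge L)
        where
        open ≤-Reasoning
        arith : ∀ e r s t f v g m c → m ≡ e + r → g + 2 * suc t ≤ f + r + 2 * c → v + g ≡ m + 2 * c →
          v ≤ s + t → 8 * f ≤ 4 * e + 8 * t → e ≤ 2 * s
        arith e r s t f v g m c refl deleted eu v≤ dis = *-cancelˡ-≤ 4 (+-cancelʳ-≤ X (4 * e) (4 * (2 * s)) (begin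
          4 * e + X
            -- The inequalities in fact give e ≤ 2s - 4; scaled by 4, this is the 16 dropped here.
            -- It stems from counting `S` itself as a component. `X` collects what occurs on both
            -- sides.
            ≤⟨ m≤m+n _ 16 ⟩
          4 * e + X + 16
            ≡⟨ solve 7 (λ e r c t f v g →
                 con 4 :* e :+ (con 8 :* f :+ con 4 :* e :+ con 16 :* t :+ con 8 :* (r :+ con 2 :* c) :+ con 8 :* (v :+ g)) :+ con 16
                 := con 8 :* (g :+ con 2 :* (con 1 :+ t)) :+ con 8 :* ((e :+ r) :+ con 2 :* c) :+ con 8 :* v :+ con 8 :* f)
                 refl e r c t f v g ⟩
          8 * (g + 2 * suc t) + 8 * ((e + r) + 2 * c) + 8 * v + 8 * f
            ≤⟨ +-mono-≤ (+-mono-≤ (+-mono-≤ (*-monoʳ-≤ 8 deleted) (*-monoʳ-≤ 8 (≤-reflexive (sym eu)))) (*-monoʳ-≤ 8 v≤)) dis ⟩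
          8 * (f + r + 2 * c) + 8 * (v + g) + 8 * (s + t) + (4 * e + 8 * t)
            ≡⟨ solve 8 (λ e r c t f v g s →
                 con 8 :* (f :+ r :+ con 2 :* c) :+ con 8 :* (v :+ g) :+ con 8 :* (s :+ t) :+ (con 4 :* e :+ con 8 :* t)
                 := con 4 :* (con 2 :* s) :+ (con 8 :* f :+ con 4 :* e :+ con 16 :* t :+ con 8 :* (r :+ con 2 :* c) :+ con 8 :* (v :+ g)))
                 refl e r c t f v g s ⟩
          4 * (2 * s) + X ∎))
          where
          X : ℕ
          X = 8 * f + 4 * e + 16 * t + 8 * (r + 2 * c) + 8 * (v + g)

  kept : List (Fin n) → List (Fin m)
  kept S = Restrict.kept S

  kept-remove : ∀ {S s} (xs : List (D m)) → (∀ {x} → Restrict.Real S x → tl x ≡ s → x ∈ xs) →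
    length (kept S) ≤ length xs + length (kept (filter (λ v → ¬? (v Fin.≟ s)) S))
  kept-remove {S} {s} xs all = begin
    length (kept S)                              ≤⟨ length-⊆ (filter⁺ (inside? S) (allFin⁺ m)) split ⟩
    length (map proj₁ xs ++ kept S′)             ≡⟨ length-++ (map proj₁ xs) ⟩
    length (map proj₁ xs) + length (kept S′)     ≡⟨ cong (_+ length (kept S′)) (length-map proj₁ xs) ⟩
    length xs + length (kept S′)                 ∎
    where
    open ≤-Reasoning
    S′ : List (Fin n)
    S′ = filter (λ v → ¬? (v Fin.≟ s)) S
    split : ∀ {i} → i ∈ kept S → i ∈ map proj₁ xs ++ kept S′
    split {i} i∈ with ∈-filter⁻ (inside? S) {xs = allFin m} i∈
    ... | _ , (a , b) with tl (i , false) Fin.≟ s | tl (i , true) Fin.≟ s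
    ... | yes eq | _      = ∈-++⁺ˡ (∈-map⁺ proj₁ (all {i , false} (a , b) eq))
    ... | no _   | yes eq = ∈-++⁺ˡ (∈-map⁺ proj₁ (all {i , true} (a , b) eq))
    ... | no ne  | no ne′ = ∈-++⁺ʳ (map proj₁ xs) (∈-filter⁺ (inside? S′) (∈-allFin i)
          (∈-filter⁺ (λ v → ¬? (v Fin.≟ s)) a ne , ∈-filter⁺ (λ v → ¬? (v Fin.≟ s)) b ne′))

  sparse : ∀ fuel S → length S ≤ fuel → Unique S → length (kept S) ≤ 2 * length S
  -- A vertex of degree at most 2 in G[S] takes at most 2 edges with it, just what the bound loses
  -- when |S| drops by one.
  sparse-remove : ∀ fuel S → length S ≤ suc fuel → Unique S → ∀ {s} → s ∈ S → (xs : List (D m)) → length xs ≤ 2 →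
    (∀ {x} → Restrict.Real S x → tl x ≡ s → x ∈ xs) → length (kept S) ≤ 2 * length S

  sparse-remove fuel S S≤ u {s} s∈S xs xs≤2 all = begin
    length (kept S)               ≤⟨ kept-remove xs all ⟩
    length xs + length (kept S′)  ≤⟨ +-mono-≤ xs≤2 (sparse fuel S′ (s≤s⁻¹ (≤-trans S′<S S≤)) (filter⁺ _ u)) ⟩
    2 + 2 * length S′             ≡⟨ *-suc 2 (length S′) ⟨
    2 * suc (length S′)           ≤⟨ *-monoʳ-≤ 2 S′<S ⟩
    2 * length S                  ∎
    where
    open ≤-Reasoning
    S′ : List (Fin n)
    S′ = filter (λ v → ¬? (v Fin.≟ s)) S
    S′<S : length S′ < length S
    S′<S = filter-notAll (λ v → ¬? (v Fin.≟ s)) S (lose s∈S λ ne → ne refl)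

  sparse fuel [] _ _ = length-⊆ {ys = []} (filter⁺ (inside? []) (allFin⁺ m))
    λ i∈ → contradiction (proj₁ (proj₂ (∈-filter⁻ (inside? []) {xs = allFin m} i∈))) λ ()
  sparse (suc fuel) S@(s₀ ∷ _) S≤ u with Any.any? (λ s → ¬? (incident? s)) S
    where
    open Restrict S
    incident? : ∀ s → Dec (∃[ i ] ∃[ b ] (Real (i , b) × tl (i , b) ≡ s))
    incident? s = Fin.any? λ i → any-Bool? λ b → real? (i , b) ×-dec (tl (i , b) Fin.≟ s)
  ... | yes isolated = let s , s∈ , none = find isolated in
        sparse-remove fuel S S≤ u s∈ [] z≤n λ {x} r eq → contradiction (proj₁ x , proj₂ x , r , eq) none
  ... | no ¬isolated with Fin.any? (λ i → any-Bool? λ b → Restrict.real? S (i , b) ×-dec (Restrict.σᴿ S (Restrict.σᴿ S (i , b)) ≟ᴰ (i , b)))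
  -- A rotation that closes after two steps lists all real darts at this vertex, so its degree is at
  -- most 2.
  ... | yes (i , b , r , back) = sparse-remove fuel S S≤ u (Restrict.Real⇒tl∈S S r)
        ((i , b) ∷ Restrict.σᴿ S (i , b) ∷ []) ≤-refl
        λ rx eq → short (Restrict.short-orbit S back r rx (sym eq))
    where
    short : ∀ {x} → x ≡ (i , b) ⊎ x ≡ Restrict.σᴿ S (i , b) → x ∈ (i , b) ∷ Restrict.σᴿ S (i , b) ∷ []
    short (inj₁ eq) = here eq
    short (inj₂ eq) = there (here eq)
  ... | no ¬short = Euler.dense-bound S u
        (λ {x} r back → ¬short (proj₁ x , proj₂ x , r , back)) incident
        {proj₁ (incident (here refl))} (proj₁ (proj₂ (incident (here refl))))
    where
    open Restrict S
    incident : ∀ {v} → v ∈ S → ∃[ x ] (Real x × tl x ≡ v)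
    incident v∈ = let i , b , r , eq = decidable-stable (Fin.any? λ i → any-Bool? λ b → real? (i , b) ×-dec (tl (i , b) Fin.≟ _)) (λ none → ¬isolated (lose v∈ none))
                  in (i , b) , r , eq

-- Planar graphs

module Cycles {n : ℕ} (G : Graph n) where

  Adj⇒≢ : ∀ {u v} → Adj G u v → u ≢ v
  Adj⇒≢ e refl = Graph.loopless G e

  triangle : ∀ {a b c} → Adj G a b → Adj G b c → Adj G c a → Triangle G
  triangle {a} {b} {c} ab bc ca = record { 3≤k = ≤-refl ; vertex = vertex ; injective = injective ; closed = closed }
    where
    vertex : Fin 3 → Fin n
    vertex 0F = a
    vertex 1F = b
    vertex 2F = c
    injective : Injective _≡_ _≡_ vertex
    injective {0F} {0F} _  = refl
    injective {0F} {1F} eq = contradiction eq (Adj⇒≢ ab)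
    injective {0F} {2F} eq = contradiction (sym eq) (Adj⇒≢ ca)
    injective {1F} {0F} eq = contradiction (sym eq) (Adj⇒≢ ab)
    injective {1F} {1F} _  = refl
    injective {1F} {2F} eq = contradiction eq (Adj⇒≢ bc)
    injective {2F} {0F} eq = contradiction eq (Adj⇒≢ ca)
    injective {2F} {1F} eq = contradiction (sym eq) (Adj⇒≢ bc)
    injective {2F} {2F} _  = refl
    closed : ∀ i → Adj G (vertex i) (vertex (next i))
    closed 0F = ab
    closed 1F = bc
    closed 2F = ca

  square : ∀ {a b c d} → Adj G a b → Adj G b c → Adj G c d → Adj G d a → a ≢ c → b ≢ d → Cycle G 4
  square {a} {b} {c} {d} ab bc cd da a≢c b≢d =
    record { 3≤k = n≤1+n 3 ; vertex = vertex ; injective = injective ; closed = closed }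
    where
    vertex : Fin 4 → Fin n
    vertex 0F = a
    vertex 1F = b
    vertex 2F = c
    vertex 3F = d
    injective : Injective _≡_ _≡_ vertex
    injective {0F} {0F} _  = refl
    injective {0F} {1F} eq = contradiction eq (Adj⇒≢ ab)
    injective {0F} {2F} eq = contradiction eq a≢c
    injective {0F} {3F} eq = contradiction (sym eq) (Adj⇒≢ da)
    injective {1F} {0F} eq = contradiction (sym eq) (Adj⇒≢ ab)
    injective {1F} {1F} _  = refl
    injective {1F} {2F} eq = contradiction eq (Adj⇒≢ bc)
    injective {1F} {3F} eq = contradiction eq b≢d
    injective {2F} {0F} eq = contradiction (sym eq) a≢c
    injective {2F} {1F} eq = contradiction (sym eq) (Adj⇒≢ bc)
    injective {2F} {2F} _  = refl
    injective {2F} {3F} eq = contradiction eq (Adj⇒≢ cd)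
    injective {3F} {0F} eq = contradiction eq (Adj⇒≢ da)
    injective {3F} {1F} eq = contradiction (sym eq) b≢d
    injective {3F} {2F} eq = contradiction (sym eq) (Adj⇒≢ cd)
    injective {3F} {3F} _  = refl
    closed : ∀ i → Adj G (vertex i) (vertex (next i))
    closed 0F = ab
    closed 1F = bc
    closed 2F = cd
    closed 3F = da

  triangle-neighbour : ∀ {a b c v} (ab : Adj G a b) (bc : Adj G b c) (ca : Adj G c a) →
    Cycle.HasEdge (triangle ab bc ca) a v → v ≡ b ⊎ v ≡ c
  triangle-neighbour ab bc ca (0F , inj₁ (_ , v≡b)) = inj₁ v≡b
  triangle-neighbour ab bc ca (0F , inj₂ (a≡b , _)) = contradiction a≡b (Adj⇒≢ ab)
  triangle-neighbour ab bc ca (1F , inj₁ (a≡b , _)) = contradiction a≡b (Adj⇒≢ ab)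
  triangle-neighbour ab bc ca (1F , inj₂ (a≡c , _)) = contradiction (sym a≡c) (Adj⇒≢ ca)
  triangle-neighbour ab bc ca (2F , inj₁ (a≡c , _)) = contradiction (sym a≡c) (Adj⇒≢ ca)
  triangle-neighbour ab bc ca (2F , inj₂ (_ , v≡c)) = inj₂ v≡c

  square-neighbour : ∀ {a b c d v} (ab : Adj G a b) (bc : Adj G b c) (cd : Adj G c d) (da : Adj G d a) (a≢c : a ≢ c) (b≢d : b ≢ d) →
    Cycle.HasEdge (square ab bc cd da a≢c b≢d) v a → v ≡ b ⊎ v ≡ d
  square-neighbour ab bc cd da a≢c b≢d (0F , inj₁ (_ , a≡b)) = contradiction a≡b (Adj⇒≢ ab)
  square-neighbour ab bc cd da a≢c b≢d (0F , inj₂ (v≡b , _)) = inj₁ v≡b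
  square-neighbour ab bc cd da a≢c b≢d (1F , inj₁ (_ , a≡c)) = contradiction a≡c a≢c
  square-neighbour ab bc cd da a≢c b≢d (1F , inj₂ (_ , a≡b)) = contradiction a≡b (Adj⇒≢ ab)
  square-neighbour ab bc cd da a≢c b≢d (2F , inj₁ (_ , a≡d)) = contradiction (sym a≡d) (Adj⇒≢ da)
  square-neighbour ab bc cd da a≢c b≢d (2F , inj₂ (_ , a≡c)) = contradiction a≡c a≢c
  square-neighbour ab bc cd da a≢c b≢d (3F , inj₁ (v≡d , _)) = inj₂ v≡d
  square-neighbour ab bc cd da a≢c b≢d (3F , inj₂ (_ , a≡d)) = contradiction (sym a≡d) (Adj⇒≢ da)

  -- The hypothesis only refutes that the triangles differ, so the conclusion is obtained by
  -- deciding it. If the cycles are the same, `a` has the same two neighbours on both.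
  triangles-at : NoTwoIntersectingTriangles G → ∀ {a b c b′ c′} →
    Adj G a b → Adj G b c → Adj G c a → Adj G a b′ → Adj G b′ c′ → Adj G c′ a →
    (b ≡ b′ × c ≡ c′) ⊎ (b ≡ c′ × c ≡ b′)
  triangles-at disjoint {a} {b} {c} {b′} {c′} ab bc ca ab′ bc′ ca′ =
    decidable-stable (((b Fin.≟ b′) ×-dec (c Fin.≟ c′)) ⊎-dec ((b Fin.≟ c′) ×-dec (c Fin.≟ b′)))
      λ differ → disjoint S T (λ same → differ (conclude same)) (0F , 0F , refl)
    where
    S T : Triangle G
    S = triangle ab bc ca
    T = triangle ab′ bc′ ca′
    conclude : SameCycle S T → (b ≡ b′ × c ≡ c′) ⊎ (b ≡ c′ × c ≡ b′)
    conclude same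
      with triangle-neighbour ab′ bc′ ca′ (Equivalence.to (same a b) (0F , inj₁ (refl , refl)))
         | triangle-neighbour ab′ bc′ ca′ (Equivalence.to (same a c) (2F , inj₂ (refl , refl)))
    ... | inj₁ p | inj₂ q = inj₁ (p , q)
    ... | inj₂ p | inj₁ q = inj₂ (p , q)
    ... | inj₁ p | inj₁ q = contradiction (trans p (sym q)) (Adj⇒≢ bc)
    ... | inj₂ p | inj₂ q = contradiction (trans p (sym q)) (Adj⇒≢ bc)

  squares-at : TrianglesAdjacentToAtMostOne4Cycle G → ∀ {u v w p q p′ q′} →
    Adj G u v → Adj G v w → Adj G w u →
    Adj G v u → Adj G u p → Adj G p q → Adj G q v → v ≢ p → u ≢ q →
    Adj G w v → Adj G v p′ → Adj G p′ q′ → Adj G q′ w → w ≢ p′ → v ≢ q′ → w ≡ q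
  squares-at one {u} {v} {w} uv vw wu vu up pq qv v≢p u≢q wv vp′ pq′ qw′ w≢p′ v≢q′
    with square-neighbour vu up pq qv v≢p u≢q
           (Equivalence.from (one (triangle uv vw wu) (square vu up pq qv v≢p u≢q) (square wv vp′ pq′ qw′ w≢p′ v≢q′)
             (u , v , (0F , inj₁ (refl , refl)) , (0F , inj₂ (refl , refl)))
             (v , w , (1F , inj₁ (refl , refl)) , (0F , inj₂ (refl , refl))) w v)
             (0F , inj₁ (refl , refl)))
  ... | inj₁ w≡u = contradiction w≡u (Adj⇒≢ wu)
  ... | inj₂ w≡q = w≡q

-- From a planar graph to a plane map on numbered darts

module Enumerate {n : ℕ} (G : Graph n) (planar : Planar G)
                 (disjoint : NoTwoIntersectingTriangles G) (one : TrianglesAdjacentToAtMostOne4Cycle G) where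
  module P = Planar planar
  open P using () renaming (E to m)
  open Darts {m}
  open Cycles G
  open Dart

  dart-ext : {d d′ : Dart G} → tail d ≡ tail d′ → head d ≡ head d′ → d ≡ d′
  dart-ext {dart u v e} {dart _ _ e′} refl refl = cong (dart u v) (T-irrelevant e e′)

  reverse-involutive : (d : Dart G) → reverse (reverse d) ≡ d
  reverse-involutive d = dart-ext refl refl

  reverse-≢ : (d : Dart G) → reverse d ≢ d
  reverse-≢ d eq = Adj⇒≢ (edge d) (sym (cong tail eq))

  edgeClass : Dart G → Fin m
  edgeClass = Classes.class P.edges

  edgeClass-reverse : ∀ d → edgeClass (reverse d) ≡ edgeClass d
  edgeClass-reverse d = sym (Equivalence.from (Classes.classifies P.edges _ _) (fwd refl ◅ ε))

  reverse-orbit : ∀ {d d′ : Dart G} → SameOrbit reverse d d′ → d ≡ d′ ⊎ reverse d ≡ d′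
  reverse-orbit ε = inj₁ refl
  reverse-orbit {d} (fwd refl ◅ rest) with reverse-orbit rest
  ... | inj₁ eq = inj₂ eq
  ... | inj₂ eq = inj₁ (trans (sym (reverse-involutive d)) eq)
  reverse-orbit (bwd refl ◅ rest) with reverse-orbit rest
  ... | inj₁ eq = inj₂ (trans (reverse-involutive _) eq)
  ... | inj₂ eq = inj₁ eq

  -- A dart chosen from each class of `reverse` fixes the `false` direction of that edge, so that
  -- `rev` becomes `reverse`.
  fromD : D m → Dart G
  fromD (i , false) = proj₁ (Classes.surjective P.edges i)
  fromD (i , true)  = reverse (fromD (i , false))

  fromD-rev : ∀ x → fromD (rev x) ≡ reverse (fromD x)
  fromD-rev (i , false) = refl
  fromD-rev (i , true)  = sym (reverse-involutive _)

  fromD-edge : ∀ x → edgeClass (fromD x) ≡ proj₁ x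
  fromD-edge (i , false) = proj₂ (Classes.surjective P.edges i)
  fromD-edge (i , true)  = trans (edgeClass-reverse _) (fromD-edge (i , false))

  fromD-injective : Injective _≡_ _≡_ fromD
  fromD-injective {i , b} {j , c} eq with trans (sym (fromD-edge (i , b))) (trans (cong edgeClass eq) (fromD-edge (j , c)))
  fromD-injective {i , false} {i , false} eq | refl = refl
  fromD-injective {i , true}  {i , true}  eq | refl = refl
  fromD-injective {i , false} {i , true}  eq | refl = contradiction (sym eq) (reverse-≢ _)
  fromD-injective {i , true}  {i , false} eq | refl = contradiction eq (reverse-≢ _)

  toD′ : ∀ d → ∃[ x ] fromD x ≡ d
  toD′ d with reverse-orbit (Equivalence.to (Classes.classifies P.edges _ _) (fromD-edge (edgeClass d , false)))
  ... | inj₁ eq = (edgeClass d , false) , eq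
  ... | inj₂ eq = (edgeClass d , true) , eq

  toD : Dart G → D m
  toD = proj₁ ∘ toD′

  fromD-toD : ∀ d → fromD (toD d) ≡ d
  fromD-toD = proj₂ ∘ toD′

  toD-fromD : ∀ x → toD (fromD x) ≡ x
  toD-fromD x = fromD-injective (fromD-toD (fromD x))

  σ : D m → D m
  σ = toD ∘ P.σ ∘ fromD

  tl hd : D m → Fin n
  tl = tail ∘ fromD
  hd = tl ∘ rev

  σ-injective : Injective _≡_ _≡_ σ
  σ-injective {x} {y} eq = fromD-injective (trans (sym (Inverse.strictlyInverseʳ P.rotation (fromD x)))
    (trans (cong (Inverse.from P.rotation) (trans (sym (fromD-toD _)) (trans (cong fromD eq) (fromD-toD _))))
           (Inverse.strictlyInverseʳ P.rotation (fromD y))))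

  toD-σ : ∀ {d d′} → P.σ d ≡ d′ → σ (toD d) ≡ toD d′
  toD-σ {d} eq = cong toD (trans (cong P.σ (fromD-toD d)) eq)

  toD-reverse : ∀ d → rev (toD d) ≡ toD (reverse d)
  toD-reverse d = fromD-injective (trans (fromD-rev (toD d)) (trans (cong reverse (fromD-toD d)) (sym (fromD-toD _))))

  hd-head : ∀ x → hd x ≡ head (fromD x)
  hd-head x = cong tail (fromD-rev x)

  adjacent : ∀ x {v} → hd x ≡ v → Adj G (tl x) v
  adjacent x eq = subst (Adj G (tl x)) (trans (sym (hd-head x)) eq) (edge (fromD x))

  same-tail : ∀ {d d′} → SameOrbit P.σ d d′ → tail d ≡ tail d′
  same-tail = Eq.gfold isEquivalence tail λ {d} eq → trans (sym (P.σ-tail d)) (cong tail eq)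

  planeMap : PlaneMap n m
  planeMap = record
    { σ           = σ
    ; σ-injective = σ-injective
    ; tl          = tl
    ; tl-σ        = λ x → trans (cong tail (fromD-toD _)) (P.σ-tail (fromD x))
    ; cyclic      = λ {x} {y} eq → subst₂ (SameOrbit σ) (toD-fromD x) (toD-fromD y)
                      (Eq.gmap toD toD-σ (P.σ-cyclic (fromD x) (fromD y) eq))
    ; loopless    = λ x → Adj⇒≢ (adjacent x refl)
    ; simple      = λ {x} {y} p q → fromD-injective (dart-ext p (trans (sym (hd-head x)) (trans q (hd-head y))))
    ; V           = P.V
    ; F           = P.F
    ; C           = P.C
    ; rep         = toD ∘ proj₁ ∘ Classes.surjective P.vertices
    ; cls         = Classes.class P.vertices ∘ fromD
    ; rep-unique  = λ {i} {j} eq → trans (sym (proj₂ (Classes.surjective P.vertices i)))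
                      (trans (Equivalence.from (Classes.classifies P.vertices _ _)
                               (P.σ-cyclic _ _ (trans (cong tail (sym (fromD-toD _))) (trans eq (cong tail (fromD-toD _))))))
                             (proj₂ (Classes.surjective P.vertices j)))
    ; rep-cls     = λ x → trans (cong tail (fromD-toD _))
                      (same-tail (Equivalence.to (Classes.classifies P.vertices _ _)
                        (proj₂ (Classes.surjective P.vertices (Classes.class P.vertices (fromD x))))))
    ; faces       = record
        { label      = Classes.class P.faces ∘ fromD
        ; surjective = λ f → let d , eq = Classes.surjective P.faces f in
                         toD d , trans (cong (Classes.class P.faces) (fromD-toD d)) eq
        ; invariant  = λ x → Equivalence.from (Classes.classifies P.faces _ _)
                         (bwd (trans (cong P.σ (sym (fromD-rev x))) (sym (fromD-toD _))) ◅ ε)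
        }
    ; components  = components
    ; euler       = P.euler
    ; triangles   = λ {x} {y} {z} {x′} {y′} {z′} (p , q , r) (p′ , q′ , r′) eq →
        triangles-at disjoint (adjacent x p) (adjacent y q) (adjacent z r)
          (subst (λ v → Adj G v (tl y′)) (sym eq) (adjacent x′ p′)) (adjacent y′ q′) (adjacent z′ (trans r′ (sym eq)))
    ; quads       = λ {x} {y} {z} {p₁} {p₂} {p₃} {q₁} {q₂} {q₃} → quads x y z p₁ p₂ p₃ q₁ q₂ q₃
    }
    where
    components : ∀ {K} (κ : Labelling σ K) → (∀ x → label κ (rev x) ≡ label κ x) → K ≤ P.C
    -- Choose a dart for each label. As `κ` is constant on components, different labels give darts
    -- in different components.
    components {K} κ inv = Fin.injective⇒≤ {f = λ k → Classes.class P.components (fromD (proj₁ (surjective κ k)))} λ {i} {j} eq →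
      trans (sym (proj₂ (surjective κ i))) (trans (separate _ _ eq) (proj₂ (surjective κ j)))
      where
      step : ∀ {d d′} → P.σ d ≡ d′ ⊎ reverse d ≡ d′ → label κ (toD d) ≡ label κ (toD d′)
      step {d} (inj₁ eq)   = trans (sym (invariant κ (toD d))) (cong (label κ) (toD-σ eq))
      step {d} (inj₂ refl) = trans (sym (inv (toD d))) (cong (label κ) (toD-reverse d))
      separate : ∀ x y → Classes.class P.components (fromD x) ≡ Classes.class P.components (fromD y) → label κ x ≡ label κ y
      separate x y eq = subst₂ (λ x y → label κ x ≡ label κ y) (toD-fromD x) (toD-fromD y)
        (Eq.gfold isEquivalence (label κ ∘ toD) step (Equivalence.to (Classes.classifies P.components _ _) eq))
    hd-rev : ∀ x → hd (rev x) ≡ tl x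
    hd-rev x = cong tl (rev-involutive x)
    quads : ∀ x y z p₁ p₂ p₃ q₁ q₂ q₃ →
      hd x ≡ tl y × hd y ≡ tl z × hd z ≡ tl x →
      hd (rev x) ≡ tl p₁ × hd p₁ ≡ tl p₂ × hd p₂ ≡ tl p₃ × hd p₃ ≡ hd x × hd x ≢ tl p₂ × tl p₁ ≢ tl p₃ →
      hd (rev y) ≡ tl q₁ × hd q₁ ≡ tl q₂ × hd q₂ ≡ tl q₃ × hd q₃ ≡ hd y × hd y ≢ tl q₂ × tl q₁ ≢ tl q₃ →
      hd y ≡ tl p₃
    quads x y z p₁ p₂ p₃ q₁ q₂ q₃ (xy , yz , zx) (a , b , c , d , ne , ne′) (a′ , b′ , c′ , d′ , mu , mu′) =
      squares-at one {u = tl x} {v = hd x} {w = hd y}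
        (adjacent x refl) (subst (λ v → Adj G v (hd y)) (sym xy) (adjacent y refl)) (subst (λ v → Adj G v (tl x)) (sym yz) (adjacent z zx))
        (adjacent (rev x) (hd-rev x)) (subst (λ v → Adj G v (tl p₂)) (sym u≡) (adjacent p₁ b)) (adjacent p₂ c) (adjacent p₃ d)
        ne (subst (_≢ tl p₃) (sym u≡) ne′)
        (adjacent (rev y) (trans (hd-rev y) (sym xy))) (subst (λ v → Adj G v (tl q₂)) (sym v≡) (adjacent q₁ b′)) (adjacent q₂ c′) (adjacent q₃ d′)
        mu (subst (_≢ tl q₃) (sym v≡) mu′)
      where
      u≡ : tl x ≡ tl p₁
      u≡ = trans (sym (hd-rev x)) a
      v≡ : hd x ≡ tl q₁
      v≡ = trans xy (trans (sym (hd-rev y)) a′)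

  open Orientation (λ i b → tl (i , b)) using (orient; out)

  orientation : ∃[ o ] (∀ v → out (allFin m) (allFin⁺ m) o v ≤ 2)
  orientation = orient (allFin m) (allFin⁺ m) λ S → SparseBound.sparse planeMap (length S) S ≤-refl

  adaptable : AdaptablyChoosable G 3
  adaptable F L 3≤ = c , adapted , λ v → proj₁ (proj₂ (choice v))
    where
    o : Fin m → Bool
    o = proj₁ orientation
    colourOf : Dart G → ℤ
    colourOf (dart u v e) = EdgeColouring.colour F u v e
    colour-reverse : ∀ d → colourOf (reverse d) ≡ colourOf d
    colour-reverse (dart u v e) = EdgeColouring.colour-sym F v u _ e
    owner : Fin m → Fin n
    owner i = tl (i , o i)
    owned : Fin n → List (Fin m)
    owned v = filter (λ i → owner i Fin.≟ v) (allFin m)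
    edgeColour : Fin m → ℤ
    edgeColour i = colourOf (fromD (i , false))
    edgeColour-dart : ∀ x → edgeColour (proj₁ x) ≡ colourOf (fromD x)
    edgeColour-dart (i , false) = refl
    edgeColour-dart (i , true)  = sym (colour-reverse _)
    forbidden : Fin n → List ℤ
    forbidden v = map edgeColour (owned v)
    forbidden<3 : ∀ v → length (forbidden v) < 3
    forbidden<3 v = s≤s (≤-trans (≤-reflexive (trans (length-map edgeColour (owned v))
      (length-filter (λ i → owner i Fin.≟ v) (allFin m)))) (proj₂ orientation v))
    choice : ∀ v → ∃[ a ] (a ∈ ColourSet.elements (L v) × a ∉ forbidden v)
    choice v = escape ℤ._≟_ (ColourSet.unique (L v)) (≤-trans (forbidden<3 v) (3≤ v))
    c : Fin n → ℤ
    c v = proj₁ (choice v)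
    avoid : ∀ i → c (owner i) ≢ edgeColour i
    avoid i eq = proj₂ (proj₂ (choice (owner i))) (subst (_∈ forbidden (owner i)) (sym eq)
      (∈-map⁺ edgeColour (∈-filter⁺ (λ j → owner j Fin.≟ owner i) (∈-allFin i) refl)))
    adapted : AdaptedTo G F c
    adapted u v e (cu≡cv , cv≡F) = clash (toD d) (fromD-toD d)
      where
      d : Dart G
      d = dart u v e
      clash : ∀ x → fromD x ≡ d → ⊥
      -- The owner of the edge is its tail or its head. On a violated edge both ends have the edge's
      -- colour, which the owner avoids.
      clash x@(i , b) eq with o i ≟ᵇ b
      ... | yes ob = avoid i (trans (cong c (trans (cong (λ b → tl (i , b)) ob) (cong tail eq)))
                       (trans cu≡cv (trans cv≡F (sym (trans (edgeColour-dart x) (cong colourOf eq))))))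
      ... | no ob  = avoid i (trans (cong c (trans (cong (λ b → tl (i , b)) (¬-not ob)) (trans (hd-head x) (cong head eq))))
                       (trans cv≡F (sym (trans (edgeColour-dart x) (cong colourOf eq)))))

-- From adapted colourings to lists sharing at most one colour

adaptable⇒separated : ∀ {n} (G : Graph n) {k} → AdaptablyChoosable G k → Choosable G k 1
adaptable⇒separated G {k} adaptable L (k≤ , meet≤1) =
  let c , adapted , from = adaptable F L k≤ in
  -- Each edge is coloured with the one colour its end lists share. Equal colours at the two ends
  -- would be that shared colour, which adaptedness forbids.
  c , (λ u v e eq → adapted u v e (eq , sym (first-common u v e (subst (_∈ᶜ L u) eq (from u)) (from v)))) , from
  where
  first : List ℤ → ℤ
  -- An arbitrary colour for edges whose end lists are disjoint: their ends never agree.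
  first []      = 0ℤ
  first (a ∷ _) = a
  common : ∀ u v → List ℤ
  common u v = ColourSet.elements (L u ∩ L v)
  first-single : ∀ {a} (as : List ℤ) → length as ≤ 1 → a ∈ as → first as ≡ a
  first-single (_ ∷ [])    _          (here refl) = refl
  first-single (_ ∷ _ ∷ _) (s≤s ())   _
  first-common : ∀ u v (e : Adj G u v) {a} → a ∈ᶜ L u → a ∈ᶜ L v → first (common u v) ≡ a
  first-common u v e a∈u a∈v = first-single (common u v) (meet≤1 u v e)
    (∈-filter⁺ (_∈ℤ? ColourSet.elements (L v)) a∈u a∈v)
  -- The two intersections are filtered from different lists, but they have the same elements and at
  -- most one of them.
  first-sym : ∀ u v → Adj G u v → Adj G v u → first (common u v) ≡ first (common v u)
  first-sym u v e e′ = go (common u v) (common v u) refl refl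
    where
    swap∈ : ∀ u v {a} → a ∈ common u v → a ∈ᶜ L u × a ∈ᶜ L v
    swap∈ u v = ∈-filter⁻ (_∈ℤ? ColourSet.elements (L v)) {xs = ColourSet.elements (L u)}
    go : ∀ as bs → as ≡ common u v → bs ≡ common v u → first as ≡ first bs
    go (a ∷ _) _       eq refl = let a∈u , a∈v = swap∈ u v (subst (a ∈_) eq (here refl)) in
      sym (first-common v u e′ a∈v a∈u)
    go []      []      _  _    = refl
    go []      (b ∷ _) none eq = let b∈v , b∈u = swap∈ v u (subst (b ∈_) eq (here refl)) in
      contradiction (subst (b ∈_) (sym none) (∈-filter⁺ (_∈ℤ? ColourSet.elements (L v)) b∈u b∈v)) λ ()
  F : EdgeColouring G
  F = record { colour = λ u v _ → first (common u v) ; colour-sym = first-sym }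

theorem3 : ∀ (n : ℕ) (G : Graph n) →
    Planar G →
    NoTwoIntersectingTriangles G →
    TrianglesAdjacentToAtMostOne4Cycle G →
    AdaptablyChoosable G 3
      × (∀ k → IsAdaptableChoiceNumber G k → k ≤ 3)
      × Choosable G 3 1
theorem3 n G planar disjoint one =
  adaptable , (λ k (_ , least) → least 3 adaptable) , adaptable⇒separated G adaptable
  where open Enumerate G planar disjoint one
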